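{- Let $G$ be a graph with $n$ vertices and chromatic polynomial $P_G$, and suppose $G$ is chromatically equivalent to (i.e. has the same chromatic polynomial as) a graph which contains a vertex of degree $n-1$. Define $h'_0,\dots,h'_{n-2}$ by $$h'_0+h'_1t+\cdots+h'_{n-2}t^{n-2}=(1-t)^{n-1}\sum_{j=0}^\infty\frac{(j+1)^n-P_G(j+1)}{j+1}\,t^j.$$ Then (1) $h'_0\le h'_1\le\cdots\le h'_{\lfloor (n-2)/2\rfloor}$; (2) for $i\le (n-2)/2$, $h'_i\le h'_{n-2-i}$; (3) $(h'_0,\,h'_1-h'_0,\,\dots,\,h'_{\lceil (n-2)/2\rceil}-h'_{\lceil (n-2)/2\rceil-1})$ is an M-vector.
   Context: A sequence of nonnegative integers $(m_0,\dots,m_d)$ is an M-vector if it is the Hilbert function of a homogeneous quotient of a polynomial ring (standard graded), equivalently the degree sequence of an order ideal of monomials; by Macaulay's theorem this holds iff $m_0=1$ and $m_{i+1}\le m_i^{\langle i\rangle}$ for $1\le i\le d-1$, where writing $m_i=\binom{a_i}{i}+\cdots+\binom{a_j}{j}$ with $a_i>\cdots>a_j\ge j\ge1$, one sets $m_i^{\langle i\rangle}=\binom{a_i+1}{i+1}+\cdots+\binom{a_j+1}{j+1}$. -}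

module Defs where

open import Data.Nat using (ℕ; zero; suc; _+_; _*_; _∸_; _^_; _≤_; _<_)
open import Data.Nat.DivMod using (_/_)
open import Data.Nat.Combinatorics using (_C_)
open import Data.Integer as ℤ using (ℤ; +_; -_)
open import Data.Bool using (Bool; true; false; if_then_else_; _∧_; not)
open import Data.Fin using (Fin)
open import Data.Fin.Properties using (_≟_)
open import Data.Vec using (Vec; []; _∷_; lookup)
open import Data.List using (List; []; _∷_; [_]; map; concatMap)
open import Data.Nat.ListAction using (sum)
open import Data.Bool.ListAction using (and)
open import Data.List.Base using (allFin)
open import Data.Product using (Σ; _×_)
open import Data.Unit using (⊤)
open import Relation.Nullary.Decidable using (does)
open import Relation.Binary.PropositionalEquality using (_≡_)

record Graph (n : ℕ) : Set where
  field
    adj    : Fin n → Fin n → Bool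
    sym    : ∀ i j → adj i j ≡ adj j i
    irrefl : ∀ i → adj i i ≡ false
open Graph public

degree : {n : ℕ} → Graph n → Fin n → ℕ
degree {n} G v = sum (map (λ w → if adj G v w then 1 else 0) (allFin n))

allColourings : (n k : ℕ) → List (Vec (Fin k) n)
allColourings zero    k = [ [] ]
allColourings (suc n) k =
  concatMap (λ c → map (c ∷_) (allColourings n k)) (allFin k)

isProper : {n k : ℕ} → Graph n → Vec (Fin k) n → Bool
isProper {n} G c =
  and (concatMap (λ i → map (λ j → not (adj G i j ∧ does (lookup c i ≟ lookup c j)))
                             (allFin n))
                 (allFin n))

chromPoly : {n : ℕ} → Graph n → ℕ → ℕ
chromPoly {n} G k =
  sum (map (λ c → if isProper G c then 1 else 0) (allColourings n k))

-- chromatic equivalence: same chromatic polynomial (polynomials agree on ℕ)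
ChromEquiv : {n m : ℕ} → Graph n → Graph m → Set
ChromEquiv G H = ∀ k → chromPoly G k ≡ chromPoly H k

-- a_j = ((j+1)^n - P_G(j+1)) / (j+1)   (an exact division)
coeffA : {n : ℕ} → Graph n → ℕ → ℕ
coeffA {n} G j = ((suc j ^ n) ∸ chromPoly G (suc j)) / suc j

sign : ℕ → ℤ
sign zero          = + 1
sign (suc zero)    = - (+ 1)
sign (suc (suc k)) = sign k

sumTo : ℕ → (ℕ → ℤ) → ℤ
sumTo zero    f = f 0
sumTo (suc m) f = sumTo m f ℤ.+ f (suc m)

-- h'_i = coefficient of t^i in (1-t)^{n-1} * sum_j a_j t^j
--      = sum_{k=0}^{i} (-1)^k binom(n-1,k) a_{i-k}
hPrime : {n : ℕ} → Graph n → ℕ → ℤ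
hPrime {n} G i =
  sumTo i (λ k → sign k ℤ.* (+ ((n ∸ 1) C k)) ℤ.* (+ coeffA G (i ∸ k)))

diffSeq : (ℕ → ℤ) → ℕ → ℤ
diffSeq h zero    = h 0
diffSeq h (suc i) = h (suc i) ℤ.- h i

-- i-binomial (Macaulay) representation m = C(a_i,i) + C(a_{i-1},i-1) + ... + C(a_j,j)
-- encoded as the list (a_i, a_{i-1}, ..., a_j); valid iff a_i > ... > a_j >= j >= 1
ValidRep : ℕ → List ℕ → Set
ValidRep i []          = ⊤
ValidRep i (a ∷ [])    = (1 ≤ i) × (i ≤ a)
ValidRep i (a ∷ b ∷ as) = (1 ≤ i) × (i ≤ a) × (b < a) × ValidRep (i ∸ 1) (b ∷ as)

repValue : ℕ → List ℕ → ℕ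
repValue i []       = 0
repValue i (a ∷ as) = (a C i) + repValue (i ∸ 1) as

repPower : ℕ → List ℕ → ℕ
repPower i []       = 0
repPower i (a ∷ as) = (suc a C suc i) + repPower (i ∸ 1) as

-- m' ≤ m^{<i>}  (the i-binomial representation of m exists and is unique)
MacaulayBound : ℕ → ℕ → ℕ → Set
MacaulayBound i m m' =
  Σ (List ℕ) λ as → ValidRep i as × (repValue i as ≡ m) × (m' ≤ repPower i as)

-- (m_0, ..., m_d) (integer entries) is an M-vector (Macaulay's characterisation)
IsMVector : ℕ → (ℕ → ℤ) → Set
IsMVector d m =
  (m 0 ≡ + 1) ×
  (∀ i → i ≤ d → + 0 ℤ.≤ m i) ×
  (∀ i → 1 ≤ i → suc i ≤ d → MacaulayBound i (ℤ.∣ m i ∣) (ℤ.∣ m (suc i) ∣))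

{-# OPTIONS --safe #-}
module Submission where

open import Defs hiding (sym)
open import Data.Bool using (Bool; true; false; _∧_; _∨_; not; if_then_else_)
open import Data.Bool.ListAction using (and)
open import Data.Fin using (Fin; zero; suc; toℕ)
open import Data.Fin.Properties using (_≟_; toℕ-injective; suc-injective)
open import Data.Integer as ℤ using (ℤ; -_)
import Data.Integer.Properties as ℤₚ
import Data.Integer.Tactic.RingSolver as ℤ-Solver
open import Data.List using (List; []; _∷_; _++_; concatMap; allFin; cartesianProductWith) renaming (map to mapᴸ; tabulate to tabulateᴸ)
open import Data.Nat using (ℕ; zero; suc; _+_; _*_; _∸_; _^_; _!; _≤_; _<_; z≤n; s≤s; z<s; s<s; _≤?_; _<?_)
open import Data.Nat.Combinatorics using (_C_; nCn≡1; nCk+nC[k+1]≡[n+1]C[k+1])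
open import Data.Nat.DivMod using (_/_; m*n/n≡m; m/n*n≤m)
open import Data.Nat.ListAction using (sum)
open import Data.Nat.Properties hiding (_≟_; suc-injective)
open import Data.Nat.Tactic.RingSolver using (solve-∀)
open import Data.Product using (Σ; _×_; _,_; proj₁; proj₂; ∃)
open import Data.Sum using (_⊎_; inj₁; inj₂)
open import Data.Vec using (Vec; []; _∷_; lookup; insertAt; removeAt; replicate; zipWith; map; tabulate)
open import Data.Vec.Properties using (map-replicate; lookup-map; lookup∘tabulate)
open import Data.Vec.Relation.Unary.All as All using (All; []; _∷_)
open import Function using (_∘_; id)
open import Relation.Nullary using (yes; no; does; contradiction)
open import Relation.Binary.PropositionalEquality using (_≡_; _≢_; _≗_; refl; sym; trans; cong; cong₂; subst; subst₂; module ≡-Reasoning)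

-- Let m = n-1, and let P be the chromatic polynomial of the graph left after
-- deleting the universal vertex of H, so that the series in question has the
-- coefficients (j+1)^m - P(j) = ((j+1)^m - j^m) + (j^m - P(j)).
--
-- The first part has the Eulerian polynomial A_m as numerator over (1-t)^m. By
-- deletion and contraction, j^m - P(j) is a sum of chromatic polynomials of graphs
-- on m-1 vertices. The chromatic series of a graph on p >= 1 vertices has the form
-- w(t)/(1-t)^(p+1) with w a sum of polynomials t^s (1+t)^a with a + 2s >= p+1:
-- orient the edges, take a vertex x minimal for the orientation, and split the
-- colourings by the colour d of x and the set of the other vertices with colour
-- at most d. This expresses w by products of such numerators for smaller graphs,
-- where the two extreme sets contribute t w' or (1+t) w'. Hence h' is, up to its
-- Eulerian part, a sum of polynomials t^s (1+t)^a with a + 2s >= m, and the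
-- Eulerian part has the same shape with a + 2s >= m-1 (edgeless graph); this gives
-- (1) and (2).
--
-- For (3), the increments satisfy A(m,i) - A(m,i-1) <= h'_i - h'_{i-1} <= A(m,i),
-- the upper bound because the numerator of P is nonnegative. So it suffices that
-- A(m,i+1) is at most the Macaulay power of A(m,i) - A(m,i-1). Eulerian numbers
-- grow so slowly in i that crude estimates prove this.

-- Power series with coefficients in ℕ

-- Orienting the edges is what makes the splitting multiplicative. If all neighbours of x must
-- receive larger colours, then d and the set of vertices with colour at most d already decide the
-- constraints at x; every other constraint lies inside one class or is decided by the classes. In
-- an unoriented graph no vertex could be fixed in advance for this role.
--
-- The bounds p+1 and q+1 of two nonempty classes add up to exactly the bound for p+q+1 vertices. An
-- empty class, however, has the series 1/(1-t), whose numerator 1 violates the bound. Hence the two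
-- extreme sets are treated jointly: the full set alone would contribute w' with no gain in the
-- bound, and only the sum with t w' from the empty set gains.
--
-- Division by 1-t is the formation of partial sums, which is injective on sequences. Numerators are
-- therefore identified by comparing series of natural numbers, without signed coefficients; signs
-- appear only where the definition of h' is met.

Series : Set
Series = ℕ → ℕ

infixl 6 _⊕_
infixl 7 _⊛_

𝟘 δ : Series
𝟘 _ = 0
δ zero    = 1
δ (suc _) = 0

_⊕_ : Series → Series → Series
(f ⊕ g) i = f i + g i

shift : Series → Series
shift f zero    = 0
shift f (suc i) = f i

-- Division by 1-t; `iter sums k` stands for division by (1-t)^k.
sums : Series → Series
sums f zero    = f 0
sums f (suc i) = sums f i + f (suc i)

1+t : Series → Series
1+t f = f ⊕ shift f

scale : ℕ → Series → Series
scale k f i = k * f i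

tail : Series → Series
tail f i = f (suc i)

_⊛_ : Series → Series → Series
(f ⊛ g) zero    = f 0 * g 0
(f ⊛ g) (suc j) = f 0 * g (suc j) + (tail f ⊛ g) j

iter : (Series → Series) → ℕ → Series → Series
iter F zero    f = f
iter F (suc k) f = F (iter F k f)

shift-cong : ∀ {f g} → f ≗ g → shift f ≗ shift g
shift-cong p zero    = refl
shift-cong p (suc i) = p i

sums-cong : ∀ {f g} → f ≗ g → sums f ≗ sums g
sums-cong p zero    = p 0
sums-cong p (suc i) = cong₂ _+_ (sums-cong p i) (p (suc i))

1+t-cong : ∀ {f g} → f ≗ g → 1+t f ≗ 1+t g
1+t-cong p i = cong₂ _+_ (p i) (shift-cong p i)

⊛-cong : ∀ {f f′ g g′} → f ≗ f′ → g ≗ g′ → f ⊛ g ≗ f′ ⊛ g′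
⊛-cong p q zero    = cong₂ _*_ (p 0) (q 0)
⊛-cong p q (suc j) = cong₂ _+_ (cong₂ _*_ (p 0) (q (suc j))) (⊛-cong (λ i → p (suc i)) q j)

iter-cong : ∀ {F : Series → Series} → (∀ {f g} → f ≗ g → F f ≗ F g) → ∀ k {f g} → f ≗ g → iter F k f ≗ iter F k g
iter-cong c zero    p = p
iter-cong c (suc k) p = c (iter-cong c k p)

iter-+ : ∀ F k l f → iter F (k + l) f ≡ iter F k (iter F l f)
iter-+ F zero    l f = refl
iter-+ F (suc k) l f = cong F (iter-+ F k l f)

iter-commute : ∀ {F G : Series → Series} → (∀ {f g} → f ≗ g → F f ≗ F g) → (∀ f → F (G f) ≗ G (F f)) →
               ∀ k f → iter F k (G f) ≗ G (iter F k f)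
iter-commute c e zero    f i = refl
iter-commute {F} c e (suc k) f i = trans (c (iter-commute c e k f) i) (e (iter F k f) i)

shift-⊕ : ∀ f g → shift (f ⊕ g) ≗ shift f ⊕ shift g
shift-⊕ f g zero    = refl
shift-⊕ f g (suc i) = refl

interchange : ∀ a b c d → (a + b) + (c + d) ≡ (a + c) + (b + d)
interchange = solve-∀

sums-⊕ : ∀ f g → sums (f ⊕ g) ≗ sums f ⊕ sums g
sums-⊕ f g zero    = refl
sums-⊕ f g (suc i) = trans (cong (_+ (f (suc i) + g (suc i))) (sums-⊕ f g i))
                           (interchange (sums f i) (sums g i) (f (suc i)) (g (suc i)))

sums-shift : ∀ f → sums (shift f) ≗ shift (sums f)
sums-shift f zero          = refl
sums-shift f (suc zero)    = refl
sums-shift f (suc (suc i)) = cong (_+ f (suc i)) (sums-shift f (suc i))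

sums-1+t : ∀ f → sums (1+t f) ≗ 1+t (sums f)
sums-1+t f i = trans (sums-⊕ f (shift f) i) (cong (sums f i +_) (sums-shift f i))

1+t-shift : ∀ f → 1+t (shift f) ≗ shift (1+t f)
1+t-shift f zero    = refl
1+t-shift f (suc i) = refl

sums-unfold : ∀ f → sums f ≗ f ⊕ shift (sums f)
sums-unfold f zero    = sym (+-identityʳ _)
sums-unfold f (suc i) = +-comm (sums f i) (f (suc i))

iter-sums-⊕ : ∀ k f g → iter sums k (f ⊕ g) ≗ iter sums k f ⊕ iter sums k g
iter-sums-⊕ zero    f g i = refl
iter-sums-⊕ (suc k) f g i = trans (sums-cong (iter-sums-⊕ k f g) i) (sums-⊕ (iter sums k f) (iter sums k g) i)

sums-injective : ∀ {f g} → sums f ≗ sums g → f ≗ g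
sums-injective p zero    = p 0
sums-injective {f} {g} p (suc i) =
  +-cancelˡ-≡ (sums f i) _ _ (trans (p (suc i)) (cong (_+ g (suc i)) (sym (p i))))

iter-sums-injective : ∀ k {f g} → iter sums k f ≗ iter sums k g → f ≗ g
iter-sums-injective zero    p = p
iter-sums-injective (suc k) p = iter-sums-injective k (sums-injective p)

iter-sums-zero : ∀ k f → iter sums k f 0 ≡ f 0
iter-sums-zero zero    f = refl
iter-sums-zero (suc k) f = iter-sums-zero k f

iter-sums-𝟘 : ∀ k → iter sums k 𝟘 ≗ 𝟘
iter-sums-𝟘 zero    i = refl
iter-sums-𝟘 (suc k) zero    = iter-sums-𝟘 k 0
iter-sums-𝟘 (suc k) (suc i) = cong₂ _+_ (iter-sums-𝟘 (suc k) i) (iter-sums-𝟘 k (suc i))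

⊛-distribʳ : ∀ f g h → (f ⊕ g) ⊛ h ≗ (f ⊛ h) ⊕ (g ⊛ h)
⊛-distribʳ f g h zero    = *-distribʳ-+ (h 0) (f 0) (g 0)
⊛-distribʳ f g h (suc j) = trans
  (cong₂ _+_ (*-distribʳ-+ (h (suc j)) (f 0) (g 0)) (⊛-distribʳ (tail f) (tail g) h j))
  (interchange (f 0 * h (suc j)) (g 0 * h (suc j)) ((tail f ⊛ h) j) ((tail g ⊛ h) j))

⊛-distribˡ : ∀ f g h → f ⊛ (g ⊕ h) ≗ (f ⊛ g) ⊕ (f ⊛ h)
⊛-distribˡ f g h zero    = *-distribˡ-+ (f 0) (g 0) (h 0)
⊛-distribˡ f g h (suc j) = trans
  (cong₂ _+_ (*-distribˡ-+ (f 0) (g (suc j)) (h (suc j))) (⊛-distribˡ (tail f) g h j))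
  (interchange (f 0 * g (suc j)) (f 0 * h (suc j)) ((tail f ⊛ g) j) ((tail f ⊛ h) j))

⊛-zeroˡ : ∀ g → 𝟘 ⊛ g ≗ 𝟘
⊛-zeroˡ g zero    = refl
⊛-zeroˡ g (suc j) = ⊛-zeroˡ g j

⊛-zeroʳ : ∀ f → f ⊛ 𝟘 ≗ 𝟘
⊛-zeroʳ f zero    = *-zeroʳ (f 0)
⊛-zeroʳ f (suc j) = cong₂ _+_ (*-zeroʳ (f 0)) (⊛-zeroʳ (tail f) j)

⊛-identityˡ : ∀ g → δ ⊛ g ≗ g
⊛-identityˡ g zero    = *-identityˡ (g 0)
⊛-identityˡ g (suc j) = trans (cong₂ _+_ (*-identityˡ (g (suc j))) (⊛-zeroˡ g j)) (+-identityʳ _)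

⊛-shiftˡ : ∀ f g → shift f ⊛ g ≗ shift (f ⊛ g)
⊛-shiftˡ f g zero    = refl
⊛-shiftˡ f g (suc j) = refl

⊛-shiftʳ : ∀ f g → f ⊛ shift g ≗ shift (f ⊛ g)
⊛-shiftʳ f g zero          = *-zeroʳ (f 0)
⊛-shiftʳ f g (suc zero)    = trans (cong (f 0 * g 0 +_) (*-zeroʳ (f 1))) (+-identityʳ _)
⊛-shiftʳ f g (suc (suc j)) = cong (f 0 * g (suc j) +_) (⊛-shiftʳ (tail f) g (suc j))

⊛-1+tˡ : ∀ f g → 1+t f ⊛ g ≗ 1+t (f ⊛ g)
⊛-1+tˡ f g i = trans (⊛-distribʳ f (shift f) g i) (cong ((f ⊛ g) i +_) (⊛-shiftˡ f g i))

-- The equation x = a + t x determines the series x.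
shift-fixpoint : ∀ {x y} a → x ≗ a ⊕ shift x → y ≗ a ⊕ shift y → x ≗ y
shift-fixpoint a p q zero    = trans (p 0) (sym (q 0))
shift-fixpoint a p q (suc i) =
  trans (p (suc i)) (trans (cong (a (suc i) +_) (shift-fixpoint a p q i)) (sym (q (suc i))))

⊛-sumsˡ : ∀ f g → sums f ⊛ g ≗ sums (f ⊛ g)
⊛-sumsˡ f g = shift-fixpoint (f ⊛ g)
  (λ i → trans (⊛-cong (sums-unfold f) (λ _ → refl) i)
        (trans (⊛-distribʳ f (shift (sums f)) g i) (cong ((f ⊛ g) i +_) (⊛-shiftˡ (sums f) g i))))
  (sums-unfold (f ⊛ g))

⊛-sumsʳ : ∀ f g → f ⊛ sums g ≗ sums (f ⊛ g)
⊛-sumsʳ f g = shift-fixpoint (f ⊛ g)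
  (λ i → trans (⊛-cong {f = f} (λ _ → refl) (sums-unfold g) i)
        (trans (⊛-distribˡ f g (shift (sums g)) i) (cong ((f ⊛ g) i +_) (⊛-shiftʳ f (sums g) i))))
  (sums-unfold (f ⊛ g))

⊛-iterˡ : ∀ {F : Series → Series} → (∀ {f g} → f ≗ g → F f ≗ F g) → (∀ f g → F f ⊛ g ≗ F (f ⊛ g)) →
          ∀ k f g → iter F k f ⊛ g ≗ iter F k (f ⊛ g)
⊛-iterˡ c e zero    f g i = refl
⊛-iterˡ {F} c e (suc k) f g i = trans (e (iter F k f) g i) (c (⊛-iterˡ c e k f g) i)

⊛-iter-sumsʳ : ∀ k f g → f ⊛ iter sums k g ≗ iter sums k (f ⊛ g)
⊛-iter-sumsʳ zero    f g i = refl
⊛-iter-sumsʳ (suc k) f g i = trans (⊛-sumsʳ f (iter sums k g) i) (sums-cong (⊛-iter-sumsʳ k f g) i)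

mono : ℕ → ℕ → Series
mono s a = iter shift s (iter 1+t a δ)

mono-⊛ : ∀ s a s′ a′ → mono s a ⊛ mono s′ a′ ≗ mono (s + s′) (a + a′)
mono-⊛ s a s′ a′ i = begin
  (mono s a ⊛ mono s′ a′) i
    ≡⟨ ⊛-iterˡ shift-cong ⊛-shiftˡ s _ _ i ⟩
  iter shift s (iter 1+t a δ ⊛ mono s′ a′) i
    ≡⟨ iter-cong shift-cong s (⊛-iterˡ 1+t-cong ⊛-1+tˡ a δ _) i ⟩
  iter shift s (iter 1+t a (δ ⊛ mono s′ a′)) i
    ≡⟨ iter-cong shift-cong s (iter-cong 1+t-cong a (⊛-identityˡ _)) i ⟩
  iter shift s (iter 1+t a (iter shift s′ (iter 1+t a′ δ))) i
    ≡⟨ iter-cong shift-cong s (swap a s′) i ⟩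
  iter shift s (iter shift s′ (iter 1+t a (iter 1+t a′ δ))) i
    ≡⟨ cong (λ h → iter shift s (iter shift s′ h) i) (iter-+ 1+t a a′ δ) ⟨
  iter shift s (iter shift s′ (iter 1+t (a + a′) δ)) i
    ≡⟨ cong (λ h → h i) (iter-+ shift s s′ _) ⟨
  mono (s + s′) (a + a′) i ∎
  where
  open ≡-Reasoning
  swap : ∀ a s′ {f} → iter 1+t a (iter shift s′ f) ≗ iter shift s′ (iter 1+t a f)
  swap a zero     i = refl
  swap a (suc s′) {f} i = trans (iter-commute 1+t-cong 1+t-shift a (iter shift s′ f) i) (shift-cong (swap a s′) i)

mono-1+t : ∀ s a → 1+t (mono s a) ≗ mono s (suc a)
mono-1+t zero    a i = refl
mono-1+t (suc s) a i = trans (1+t-shift (mono s a) i) (shift-cong (mono-1+t s a) i)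

-- t^s (1+t)^a is symmetric about s + a/2 and its coefficients increase up to there.
mono-≤ : ∀ s a {i j} → i ≤ j → i + j ≤ a + 2 * s → mono s a i ≤ mono s a j
mono-≤ zero zero {zero} {zero} _ _ = ≤-refl
mono-≤ zero (suc a) {i} {j} i≤j q with m≤n⇒m<n∨m≡n i≤j
... | inj₂ refl = ≤-refl
mono-≤ zero (suc a) {i} {suc j} i≤j q | inj₁ (s≤s i≤j′) =
  -- With c the coefficients of (1+t)^a, Pascal's terms are paired crosswise, c_i with c_j and
  -- c_(i-1) with c_(j+1), so that both index sums stay at most a.
  subst (mono 0 (suc a) i ≤_) (+-comm (mono 0 a j) (mono 0 a (suc j)))
    (+-mono-≤ (mono-≤ 0 a i≤j′ q′) (low i i≤j q))
  where
  q′ : i + j ≤ a + 0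
  q′ = ≤-pred (subst (_≤ suc a + 0) (+-suc i j) q)
  low : ∀ i → i ≤ suc j → i + suc j ≤ suc a + 0 → shift (mono 0 a) i ≤ mono 0 a (suc j)
  low zero    _ _ = z≤n
  low (suc i) p r = mono-≤ 0 a (≤-trans (n≤1+n i) p) (≤-pred r)
mono-≤ (suc s) a {zero}  {j}     _ _ = z≤n
mono-≤ (suc s) a {suc i} {suc j} (s≤s i≤j) q =
  mono-≤ s a i≤j (≤-pred (≤-pred (subst₂ _≤_ (cong suc (+-suc i j)) (lemma a s) q)))
  where
  lemma : ∀ a s → a + 2 * suc s ≡ 2 + (a + 2 * s)
  lemma = solve-∀

-- The cone of numerators

-- The bound places the centre s + a/2 of each generator at (p+1)/2 or beyond. The constructor
-- `resp` is there because series are functions, compared only pointwise.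
data Cone (p : ℕ) : Series → Set where
  gen  : ∀ s a → suc p ≤ a + 2 * s → Cone p (mono s a)
  none : Cone p 𝟘
  plus : ∀ {f g} → Cone p f → Cone p g → Cone p (f ⊕ g)
  resp : ∀ {f g} → f ≗ g → Cone p f → Cone p g

Cone-≤ : ∀ {p w} → Cone p w → ∀ {i j} → i ≤ j → i + j ≤ suc p → w i ≤ w j
Cone-≤ (gen s a b)  i≤j q = mono-≤ s a i≤j (≤-trans q b)
Cone-≤ none         _   _ = z≤n
Cone-≤ (plus v w)   i≤j q = +-mono-≤ (Cone-≤ v i≤j q) (Cone-≤ w i≤j q)
Cone-≤ (resp e w) {i} {j} i≤j q = subst₂ _≤_ (e i) (e j) (Cone-≤ w i≤j q)

Cone-shift : ∀ {p w} → Cone p w → Cone (suc p) (shift w)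
Cone-shift {p} (gen s a b) = gen (suc s) a (≤-trans (s≤s b) (subst (suc (a + 2 * s) ≤_) (lemma a s) (n≤1+n _)))
  where
  lemma : ∀ a s → 2 + (a + 2 * s) ≡ a + 2 * suc s
  lemma = solve-∀
Cone-shift none = resp (λ { zero → refl ; (suc _) → refl }) none
Cone-shift (plus {f} {g} v w) = resp (λ i → sym (shift-⊕ f g i)) (plus (Cone-shift v) (Cone-shift w))
Cone-shift (resp e w) = resp (shift-cong e) (Cone-shift w)

Cone-1+t : ∀ {p w} → Cone p w → Cone (suc p) (1+t w)
Cone-1+t (gen s a b) = resp (λ i → sym (mono-1+t s a i)) (gen s (suc a) (s≤s b))
Cone-1+t none = resp (λ { zero → refl ; (suc _) → refl }) none
Cone-1+t (plus {f} {g} v w) = resp e (plus (Cone-1+t v) (Cone-1+t w))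
  where
  e : 1+t f ⊕ 1+t g ≗ 1+t (f ⊕ g)
  e i = trans (interchange (f i) (shift f i) (g i) (shift g i)) (cong (f i + g i +_) (sym (shift-⊕ f g i)))
Cone-1+t (resp e w) = resp (1+t-cong e) (Cone-1+t w)

-- Centres of generators add under multiplication. The extra `suc` is the room for the vertex that
-- separates the two classes.
Cone-⊛ : ∀ {p q v w} → Cone p v → Cone q w → Cone (suc (p + q)) (v ⊛ w)
Cone-⊛ {p} {q} (gen s a b) (gen s′ a′ b′) =
  resp (λ i → sym (mono-⊛ s a s′ a′ i))
    (gen (s + s′) (a + a′) (subst₂ _≤_ (cong suc (+-suc p q)) (lemma a s a′ s′) (+-mono-≤ b b′)))
  where
  lemma : ∀ a s a′ s′ → (a + 2 * s) + (a′ + 2 * s′) ≡ (a + a′) + 2 * (s + s′)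
  lemma = solve-∀
Cone-⊛ v@(gen _ _ _) none = resp (λ i → sym (⊛-zeroʳ _ i)) none
Cone-⊛ v@(gen _ _ _) (plus w w′) = resp (λ i → sym (⊛-distribˡ _ _ _ i)) (plus (Cone-⊛ v w) (Cone-⊛ v w′))
Cone-⊛ v@(gen s a _) (resp e w) = resp (⊛-cong {f = mono s a} (λ _ → refl) e) (Cone-⊛ v w)
Cone-⊛ none w = resp (λ i → sym (⊛-zeroˡ _ i)) none
Cone-⊛ (plus v v′) w = resp (λ i → sym (⊛-distribʳ _ _ _ i)) (plus (Cone-⊛ v w) (Cone-⊛ v′ w))
Cone-⊛ (resp e v) w = resp (⊛-cong e (λ _ → refl)) (Cone-⊛ v w)

-- f = w / (1-t)^(p+1) for a numerator w in the cone.
Good : ℕ → Series → Set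
Good p f = Σ Series λ w → Cone p w × (f ≗ iter sums (suc p) w)

Good-resp : ∀ {p f g} → f ≗ g → Good p f → Good p g
Good-resp e (w , c , q) = w , c , λ i → trans (sym (e i)) (q i)

Good-𝟘 : ∀ {p} → Good p 𝟘
Good-𝟘 {p} = 𝟘 , none , λ i → sym (iter-sums-𝟘 (suc p) i)

Good-⊕ : ∀ {p f g} → Good p f → Good p g → Good p (f ⊕ g)
Good-⊕ {p} (v , c , q) (w , d , r) =
  v ⊕ w , plus c d , λ i → trans (cong₂ _+_ (q i) (r i)) (sym (iter-sums-⊕ (suc p) v w i))

Good-shift-sums : ∀ {p f} → Good p f → Good (suc p) (shift (sums f))
Good-shift-sums {p} (w , c , q) = shift w , Cone-shift c , λ i →
  trans (shift-cong (sums-cong q) i) (sym (iter-commute sums-cong sums-shift (suc (suc p)) w i))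

Good-1+t-sums : ∀ {p f} → Good p f → Good (suc p) (1+t (sums f))
Good-1+t-sums {p} (w , c , q) = 1+t w , Cone-1+t c , λ i →
  trans (1+t-cong (sums-cong q) i) (sym (iter-commute sums-cong sums-1+t (suc (suc p)) w i))

Good-⊛ : ∀ {p q f g} → Good p f → Good q g → Good (suc (p + q)) (f ⊛ g)
Good-⊛ {p} {q} {f} {g} (v , c , e) (w , d , h) = v ⊛ w , Cone-⊛ c d , eq
  where
  open ≡-Reasoning
  eq : f ⊛ g ≗ iter sums (suc (suc (p + q))) (v ⊛ w)
  eq i = begin
    (f ⊛ g) i                                       ≡⟨ ⊛-cong e h i ⟩
    (iter sums (suc p) v ⊛ iter sums (suc q) w) i   ≡⟨ ⊛-iterˡ sums-cong ⊛-sumsˡ (suc p) v _ i ⟩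
    iter sums (suc p) (v ⊛ iter sums (suc q) w) i   ≡⟨ iter-cong sums-cong (suc p) (⊛-iter-sumsʳ (suc q) v w) i ⟩
    iter sums (suc p) (iter sums (suc q) (v ⊛ w)) i ≡⟨ cong (λ h → h i) (iter-+ sums (suc p) (suc q) (v ⊛ w)) ⟨
    iter sums (suc p + suc q) (v ⊛ w) i             ≡⟨ cong (λ k → iter sums k (v ⊛ w) i) (cong suc (+-suc p q)) ⟩
    iter sums (suc (suc (p + q))) (v ⊛ w) i         ∎

-- Multiplication by (1-t)^m

sumTo-cong : ∀ i {f g : ℕ → ℤ} → (∀ k → k ≤ i → f k ≡ g k) → sumTo i f ≡ sumTo i g
sumTo-cong zero    e = e 0 z≤n
sumTo-cong (suc i) e = cong₂ ℤ._+_ (sumTo-cong i λ k p → e k (m≤n⇒m≤1+n p)) (e (suc i) ≤-refl)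

ℤ-interchange : ∀ a b c d → (a ℤ.+ b) ℤ.+ (c ℤ.+ d) ≡ (a ℤ.+ c) ℤ.+ (b ℤ.+ d)
ℤ-interchange = ℤ-Solver.solve-∀

sumTo-+ : ∀ i f g → sumTo i (λ k → f k ℤ.+ g k) ≡ sumTo i f ℤ.+ sumTo i g
sumTo-+ zero    f g = refl
sumTo-+ (suc i) f g = trans (cong (ℤ._+ (f (suc i) ℤ.+ g (suc i))) (sumTo-+ i f g))
  (ℤ-interchange (sumTo i f) (sumTo i g) (f (suc i)) (g (suc i)))

sumTo-neg : ∀ i f → sumTo i (λ k → - f k) ≡ - sumTo i f
sumTo-neg zero    f = refl
sumTo-neg (suc i) f = trans (cong (ℤ._+ (- f (suc i))) (sumTo-neg i f)) (sym (ℤₚ.neg-distrib-+ (sumTo i f) (f (suc i))))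

sumTo-front : ∀ i f → sumTo (suc i) f ≡ f 0 ℤ.+ sumTo i (f ∘ suc)
sumTo-front zero    f = refl
sumTo-front (suc i) f = trans (cong (ℤ._+ f (suc (suc i))) (sumTo-front i f)) (ℤₚ.+-assoc (f 0) _ _)

sumTo-zero : ∀ i → sumTo i (λ _ → ℤ.+ 0) ≡ ℤ.+ 0
sumTo-zero zero    = refl
sumTo-zero (suc i) = cong (ℤ._+ ℤ.+ 0) (sumTo-zero i)

sign-suc : ∀ k → sign (suc k) ≡ - sign k
sign-suc zero          = refl
sign-suc (suc zero)    = refl
sign-suc (suc (suc k)) = sign-suc k

nC0≡1 : ∀ n → n C 0 ≡ 1
nC0≡1 zero    = refl
nC0≡1 (suc n) = refl

-- The coefficient of t^i in (1-t)^m a(t).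
differences : ℕ → Series → ℕ → ℤ
differences m a i = sumTo i λ k → sign k ℤ.* (ℤ.+ (m C k)) ℤ.* (ℤ.+ a (i ∸ k))

-- Coefficient form of (1-t)^(m+1) = (1-t)^m - t (1-t)^m.
differences-pascal : ∀ m a i → differences (suc m) a (suc i) ≡ differences m a (suc i) ℤ.- differences m a i
differences-pascal m a i = begin
  differences (suc m) a (suc i)
    ≡⟨ sumTo-front i _ ⟩
  f₀ (suc m) ℤ.+ sumTo i (λ k → sign (suc k) ℤ.* ℤ.+ (suc m C suc k) ℤ.* ℤ.+ a (i ∸ k))
    ≡⟨ cong₂ ℤ._+_ (cong (λ c → ℤ.+ 1 ℤ.* ℤ.+ c ℤ.* ℤ.+ a (suc i)) (trans (nC0≡1 (suc m)) (sym (nC0≡1 m))))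
         (trans (sumTo-cong i λ k _ → step k) (sumTo-+ i u v)) ⟩
  f₀ m ℤ.+ (sumTo i u ℤ.+ sumTo i v)
    ≡⟨ ℤₚ.+-assoc (f₀ m) (sumTo i u) (sumTo i v) ⟨
  (f₀ m ℤ.+ sumTo i u) ℤ.+ sumTo i v
    ≡⟨ cong₂ ℤ._+_ (sym (sumTo-front i λ k → sign k ℤ.* ℤ.+ (m C k) ℤ.* ℤ.+ a (suc i ∸ k))) (sumTo-neg i _) ⟩
  differences m a (suc i) ℤ.- differences m a i ∎
  where
  open ≡-Reasoning
  f₀ : ℕ → ℤ
  f₀ m = sign 0 ℤ.* ℤ.+ (m C 0) ℤ.* ℤ.+ a (suc i)
  u v : ℕ → ℤ
  u k = sign (suc k) ℤ.* ℤ.+ (m C suc k) ℤ.* ℤ.+ a (i ∸ k)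
  v k = - (sign k ℤ.* ℤ.+ (m C k) ℤ.* ℤ.+ a (i ∸ k))
  lemma : ∀ s x y z → (- s) ℤ.* (x ℤ.+ y) ℤ.* z ≡ (- s) ℤ.* y ℤ.* z ℤ.+ - (s ℤ.* x ℤ.* z)
  lemma = ℤ-Solver.solve-∀
  step : ∀ k → sign (suc k) ℤ.* ℤ.+ (suc m C suc k) ℤ.* ℤ.+ a (i ∸ k) ≡ u k ℤ.+ v k
  step k = begin
    sign (suc k) ℤ.* ℤ.+ (suc m C suc k) ℤ.* ℤ.+ a (i ∸ k)
      ≡⟨ cong₂ (λ s c → s ℤ.* ℤ.+ c ℤ.* ℤ.+ a (i ∸ k)) (sign-suc k) (sym (nCk+nC[k+1]≡[n+1]C[k+1] m k)) ⟩
    (- sign k) ℤ.* (ℤ.+ (m C k) ℤ.+ ℤ.+ (m C suc k)) ℤ.* ℤ.+ a (i ∸ k)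
      ≡⟨ lemma (sign k) (ℤ.+ (m C k)) (ℤ.+ (m C suc k)) (ℤ.+ a (i ∸ k)) ⟩
    (- sign k) ℤ.* ℤ.+ (m C suc k) ℤ.* ℤ.+ a (i ∸ k) ℤ.+ v k
      ≡⟨ cong (λ s → s ℤ.* ℤ.+ (m C suc k) ℤ.* ℤ.+ a (i ∸ k) ℤ.+ v k) (sign-suc k) ⟨
    u k ℤ.+ v k ∎

-- The equation S = t S + w for the partial sums S of w, multiplied by (1-t)^m.
differences-sums : ∀ m w i → differences m (sums w) (suc i) ≡ differences m (sums w) i ℤ.+ differences m w (suc i)
differences-sums m w i = begin
  sumTo i (λ k → c k ℤ.* ℤ.+ sums w (suc i ∸ k)) ℤ.+ c (suc i) ℤ.* ℤ.+ sums w (suc i ∸ suc i)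
    ≡⟨ cong₂ ℤ._+_ (trans (sumTo-cong i step) (sumTo-+ i _ _)) (cong (λ z → c (suc i) ℤ.* ℤ.+ z) last) ⟩
  (differences m (sums w) i ℤ.+ sumTo i (λ k → c k ℤ.* ℤ.+ w (suc i ∸ k))) ℤ.+ c (suc i) ℤ.* ℤ.+ w (suc i ∸ suc i)
    ≡⟨ ℤₚ.+-assoc (differences m (sums w) i) _ _ ⟩
  differences m (sums w) i ℤ.+ differences m w (suc i) ∎
  where
  open ≡-Reasoning
  c : ℕ → ℤ
  c k = sign k ℤ.* ℤ.+ (m C k)
  last : sums w (i ∸ i) ≡ w (i ∸ i)
  last rewrite n∸n≡0 i = refl
  step : ∀ k → k ≤ i → c k ℤ.* ℤ.+ sums w (suc i ∸ k) ≡ c k ℤ.* ℤ.+ sums w (i ∸ k) ℤ.+ c k ℤ.* ℤ.+ w (suc i ∸ k)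
  step k k≤i rewrite +-∸-assoc 1 k≤i = ℤₚ.*-distribˡ-+ (c k) (ℤ.+ sums w (i ∸ k)) (ℤ.+ w (suc (i ∸ k)))

-- The bridge from the alternating sum that defines `hPrime` to numerators: multiplication by
-- (1-t)^m undoes the m-fold division.
differences-iter-sums : ∀ m w i → differences m (iter sums m w) i ≡ ℤ.+ w i
differences-iter-sums zero w zero    = ℤₚ.*-identityˡ (ℤ.+ w 0)
differences-iter-sums zero w (suc i) = begin
  differences 0 w (suc i)
    ≡⟨ sumTo-front i _ ⟩
  ℤ.+ 1 ℤ.* ℤ.+ w (suc i) ℤ.+ sumTo i (λ k → sign (suc k) ℤ.* ℤ.+ 0 ℤ.* ℤ.+ w (i ∸ k))
    ≡⟨ cong₂ ℤ._+_ (ℤₚ.*-identityˡ (ℤ.+ w (suc i)))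
         (trans (sumTo-cong i λ k _ → cong (ℤ._* ℤ.+ w (i ∸ k)) (ℤₚ.*-zeroʳ (sign (suc k)))) (sumTo-zero i)) ⟩
  ℤ.+ w (suc i) ℤ.+ ℤ.+ 0
    ≡⟨ ℤₚ.+-identityʳ _ ⟩
  ℤ.+ w (suc i) ∎
  where open ≡-Reasoning
differences-iter-sums (suc m) w i = trans (step i) (differences-iter-sums m w i)
  where
  v = iter sums m w
  cancel : ∀ a b → (a ℤ.+ b) ℤ.- a ≡ b
  cancel = ℤ-Solver.solve-∀
  step : ∀ i → differences (suc m) (sums v) i ≡ differences m v i
  step zero    = cong (λ c → ℤ.+ 1 ℤ.* ℤ.+ c ℤ.* ℤ.+ v 0) (trans (nC0≡1 (suc m)) (sym (nC0≡1 m)))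
  step (suc i) = trans (differences-pascal m (sums v) i)
    (trans (cong (ℤ._- differences m (sums v) i) (differences-sums m v i)) (cancel (differences m (sums v) i) _))

open ≤-Reasoning

-- Eulerian numbers

-- eul m i is the number of permutations of m+1 letters with i descents.
eul : ℕ → Series
eul zero    i       = δ i
eul (suc m) zero    = eul m 0
eul (suc m) (suc i) = (2 + i) * eul m (suc i) + (suc m ∸ i) * eul m i

eul-vanish : ∀ m i → m < i → eul m i ≡ 0
eul-vanish zero    (suc i) _ = refl
eul-vanish (suc m) (suc i) (s≤s m<i) = cong₂ _+_
  (trans (cong ((2 + i) *_) (eul-vanish m (suc i) (m<n⇒m<1+n m<i))) (*-zeroʳ (2 + i)))
  (trans (cong ((suc m ∸ i) *_) (eul-vanish m i m<i)) (*-zeroʳ (suc m ∸ i)))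

-- On generating functions this is f ↦ (t f)'. It takes the series of (j+1)^m to that of
-- (j+1)^(m+1).
index : Series → Series
index f j = suc j * f j

-- The product rule (t f / (1-t))' = (t f)' / (1-t) + t f / (1-t)^2. Iterating it gives the rule for
-- t f / (1-t)^k in `index-iter-sums`.
index-sums : ∀ f → index (sums f) ≗ sums (index f) ⊕ shift (sums (sums f))
index-sums f zero    = sym (+-identityʳ _)
index-sums f (suc j) = begin-equality
  suc (suc j) * (sums f j + f (suc j))
    ≡⟨ lemma₁ j (sums f j) (f (suc j)) ⟩
  (suc j * sums f j + suc (suc j) * f (suc j)) + sums f j
    ≡⟨ cong (λ z → (z + suc (suc j) * f (suc j)) + sums f j) (index-sums f j) ⟩
  ((sums (index f) j + shift (sums (sums f)) j) + suc (suc j) * f (suc j)) + sums f j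
    ≡⟨ lemma₂ (sums (index f) j) (shift (sums (sums f)) j) (suc (suc j) * f (suc j)) (sums f j) ⟩
  (sums (index f) j + suc (suc j) * f (suc j)) + (sums f j + shift (sums (sums f)) j)
    ≡⟨ cong ((sums (index f) j + suc (suc j) * f (suc j)) +_) (sums-unfold (sums f) j) ⟨
  (sums (index f) j + suc (suc j) * f (suc j)) + sums (sums f) j ∎
  where
  lemma₁ : ∀ j s a → suc (suc j) * (s + a) ≡ (suc j * s + suc (suc j) * a) + s
  lemma₁ = solve-∀
  lemma₂ : ∀ a b c d → ((a + b) + c) + d ≡ (a + c) + (d + b)
  lemma₂ = solve-∀

sums-scale : ∀ k f → sums (scale k f) ≗ scale k (sums f)
sums-scale k f zero    = refl
sums-scale k f (suc i) =
  trans (cong (_+ k * f (suc i)) (sums-scale k f i)) (sym (*-distribˡ-+ k (sums f i) (f (suc i))))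

iter-sums-scale : ∀ l k f → iter sums l (scale k f) ≗ scale k (iter sums l f)
iter-sums-scale zero    k f i = refl
iter-sums-scale (suc l) k f i =
  trans (sums-cong (iter-sums-scale l k f) i) (sums-scale k (iter sums l f) i)

index-iter-sums : ∀ k f → index (iter sums k f) ≗ iter sums k (index f) ⊕ scale k (shift (iter sums (suc k) f))
index-iter-sums zero    f j = sym (+-identityʳ _)
index-iter-sums (suc k) f j = begin-equality
  index (sums g) j
    ≡⟨ index-sums g j ⟩
  sums (index g) j + x
    ≡⟨ cong (_+ x) (sums-cong (index-iter-sums k f) j) ⟩
  sums (iter sums k (index f) ⊕ scale k (shift (sums g))) j + x
    ≡⟨ cong (_+ x) (sums-⊕ (iter sums k (index f)) (scale k (shift (sums g))) j) ⟩
  (u + sums (scale k (shift (sums g))) j) + x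
    ≡⟨ cong (λ z → (u + z) + x)
         (trans (sums-scale k (shift (sums g)) j) (cong (k *_) (sums-shift (sums g) j))) ⟩
  (u + k * x) + x
    ≡⟨ lemma u k x ⟩
  u + suc k * x ∎
  where
  g = iter sums k f
  u = iter sums (suc k) (index f) j
  x = shift (sums (sums g)) j
  lemma : ∀ u k x → (u + k * x) + x ≡ u + suc k * x
  lemma = solve-∀

-- The recurrence A_(m+1) = (1-t) (t A_m)' + (m+2) t A_m, with the subtracted term moved to the
-- left.
eul-step : ∀ m → eul (suc m) ⊕ shift (index (eul m)) ≗ index (eul m) ⊕ scale (2 + m) (shift (eul m))
eul-step m zero    = trans (+-identityʳ (eul m 0)) (sym (trans (cong₂ _+_ (*-identityˡ (eul m 0)) (*-zeroʳ (2 + m))) (+-identityʳ _)))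
eul-step m (suc i) = begin-equality
  (a + (suc m ∸ i) * eul m i) + suc i * eul m i ≡⟨ +-assoc a _ _ ⟩
  a + ((suc m ∸ i) * eul m i + suc i * eul m i) ≡⟨ cong (a +_) (lemma (i ≤? suc m)) ⟩
  a + (2 + m) * eul m i                         ∎
  where
  a = (2 + i) * eul m (suc i)
  lemma : _ → (suc m ∸ i) * eul m i + suc i * eul m i ≡ (2 + m) * eul m i
  lemma (yes i≤) = trans (sym (*-distribʳ-+ (eul m i) (suc m ∸ i) (suc i)))
    (cong (_* eul m i) (trans (+-suc (suc m ∸ i) i) (cong suc (m∸n+n≡m i≤))))
  -- Here `suc m ∸ i` is truncated, but the Eulerian number it multiplies is zero.
  lemma (no i≰) rewrite eul-vanish m i (<-trans (n<1+n m) (≰⇒> i≰)) =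
    trans (cong₂ _+_ (*-zeroʳ (suc m ∸ i)) (*-zeroʳ (suc i))) (sym (*-zeroʳ (2 + m)))

-- Worpitzky's identity in the form that the series of (j+1)^(m+1) is A_m(t) / (1-t)^(m+2). The
-- induction applies `index`; the term `s` is added on both sides because `eul-step` has its
-- negative term on the left.
worpitzky : ∀ m j → suc j ^ suc m ≡ iter sums (2 + m) (eul m) j
worpitzky zero j = trans (*-identityʳ (suc j)) (sym (lemma j))
  where
  ones : ∀ j → sums δ j ≡ 1
  ones zero    = refl
  ones (suc j) = trans (+-identityʳ _) (ones j)
  lemma : ∀ j → sums (sums δ) j ≡ suc j
  lemma zero    = refl
  lemma (suc j) = trans (cong₂ _+_ (lemma j) (ones (suc j))) (+-comm (suc j) 1)
worpitzky (suc m) j = trans (cong (suc j *_) (worpitzky m j)) (+-cancelʳ-≡ s _ _ eq)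
  where
  k = 2 + m
  A = eul m
  x = iter sums k (index A)
  s = shift (sums x) j
  y = shift (iter sums (suc k) A) j
  eq : index (iter sums k A) j + s ≡ iter sums (suc k) (eul (suc m)) j + s
  eq = begin-equality
    index (iter sums k A) j + s
      ≡⟨ cong (_+ s) (index-iter-sums k A j) ⟩
    (x j + k * y) + s
      ≡⟨ trans (+-assoc (x j) (k * y) s) (trans (cong (x j +_) (+-comm (k * y) s)) (sym (+-assoc (x j) s (k * y)))) ⟩
    (x j + s) + k * y
      ≡⟨ cong₂ _+_ (sums-unfold x j) (cong (k *_) (iter-commute sums-cong sums-shift (suc k) A j)) ⟨
    sums x j + k * iter sums (suc k) (shift A) j
      ≡⟨ cong (sums x j +_) (iter-sums-scale (suc k) k (shift A) j) ⟨
    sums x j + iter sums (suc k) (scale k (shift A)) j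
      ≡⟨ iter-sums-⊕ (suc k) (index A) (scale k (shift A)) j ⟨
    iter sums (suc k) (index A ⊕ scale k (shift A)) j
      ≡⟨ iter-cong sums-cong (suc k) (eul-step m) j ⟨
    iter sums (suc k) (eul (suc m) ⊕ shift (index A)) j
      ≡⟨ iter-sums-⊕ (suc k) (eul (suc m)) (shift (index A)) j ⟩
    iter sums (suc k) (eul (suc m)) j + iter sums (suc k) (shift (index A)) j
      ≡⟨ cong (iter sums (suc k) (eul (suc m)) j +_) (iter-commute sums-cong sums-shift (suc k) (index A) j) ⟩
    iter sums (suc k) (eul (suc m)) j + s ∎

-- eulAD a b is the number of permutations with a ascents and b descents.
eulAD : ℕ → ℕ → ℕ
eulAD a       zero    = 1
eulAD zero    (suc b) = 1
eulAD (suc a) (suc b) = (2 + b) * eulAD a (suc b) + (2 + a) * eulAD (suc a) b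

eulAD-sym : ∀ a b → eulAD a b ≡ eulAD b a
eulAD-sym zero    zero    = refl
eulAD-sym zero    (suc b) = refl
eulAD-sym (suc a) zero    = refl
eulAD-sym (suc a) (suc b) = trans (+-comm ((2 + b) * eulAD a (suc b)) _)
  (cong₂ _+_ (cong ((2 + a) *_) (eulAD-sym (suc a) b)) (cong ((2 + b) *_) (eulAD-sym a (suc b))))

eul-zero : ∀ m → eul m 0 ≡ 1
eul-zero zero    = refl
eul-zero (suc m) = eul-zero m

eul≡eulAD : ∀ a b → eul (a + b) b ≡ eulAD a b
eul≡eulAD a       zero    = eul-zero (a + 0)
eul≡eulAD zero    (suc b) rewrite eul-vanish b (suc b) (n<1+n b) | m+n∸n≡m 1 b =
  trans (cong₂ _+_ (*-zeroʳ (2 + b)) (*-identityˡ (eul b b))) (trans (eul≡eulAD zero b) (eulAD-sym zero b))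
eul≡eulAD (suc a) (suc b) = cong₂ _+_ (cong ((2 + b) *_) (eul≡eulAD a (suc b)))
  (cong₂ _*_ (trans (cong (λ z → suc z ∸ b) (+-suc a b)) (m+n∸n≡m (2 + a) b))
             (trans (cong (λ z → eul z b) (+-suc a b)) (eul≡eulAD (suc a) b)))

-- The bound (b+1)/(a+1) is the ratio of the consecutive binomial coefficients C(a+b+1, b) and
-- C(a+b+1, b+1): towards the middle, Eulerian numbers grow at least as fast as binomials. On the
-- diagonal, symmetry gives equality.
eulAD-ratio : ∀ a b → b ≤ a → suc a * eulAD (suc a) b ≤ suc b * eulAD a (suc b)
eulAD-ratio a b b≤a with m≤n⇒m<n∨m≡n b≤a
... | inj₂ refl = ≤-reflexive (cong (suc a *_) (eulAD-sym (suc a) a))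
eulAD-ratio (suc a) zero _ | inj₁ _ = begin
  suc (suc a) * 1                    ≤⟨ m≤n+m _ (2 * eulAD a 1) ⟩
  2 * eulAD a 1 + suc (suc a) * 1    ≡⟨ *-identityˡ _ ⟨
  1 * eulAD (suc a) 1                ∎
eulAD-ratio (suc a′) (suc b′) _ | inj₁ (s≤s b≤a′) = begin
  suc a * ((2 + b′) * X + (2 + a) * Y)
    ≡⟨ lemma₁ a b′ X Y ⟩
  suc a * (2 + a) * Y + suc a * (suc b * X)
    ≤⟨ +-monoˡ-≤ (suc a * (suc b * X)) (*-cancelˡ-≤ a core) ⟩
  suc b * (2 + b) * Z + suc a * (suc b * X)
    ≡⟨ lemma₂ a′ b Z X ⟩
  suc b * ((2 + b) * Z + (2 + a′) * X) ∎
  where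
  a = suc a′
  b = suc b′
  X = eulAD a b
  Y = eulAD (suc a) b′
  Z = eulAD a′ (suc b)
  lemma₁ : ∀ a b′ X Y → suc a * ((2 + b′) * X + (2 + a) * Y) ≡ suc a * (2 + a) * Y + suc a * ((2 + b′) * X)
  lemma₁ = solve-∀
  lemma₂ : ∀ a′ b Z X → suc b * (2 + b) * Z + (2 + a′) * (suc b * X) ≡ suc b * ((2 + b) * Z + (2 + a′) * X)
  lemma₂ = solve-∀
  lemma₃ : ∀ a Y → a * (suc a * (2 + a) * Y) ≡ a * (2 + a) * (suc a * Y)
  lemma₃ = solve-∀
  lemma₄ : ∀ a b X → a * (2 + a) * (b * X) ≡ (2 + a) * b * (a * X)
  lemma₄ = solve-∀
  lemma₅ : ∀ a b Z → (a * b + 2 * a) * (suc b * Z) ≡ a * (suc b * (2 + b) * Z)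
  lemma₅ = solve-∀
  lemma₆ : ∀ a b → (2 + a) * b ≡ a * b + 2 * b
  lemma₆ = solve-∀
  -- Two induction hypotheses are chained, from Y to X and from X to Z. The only other loss is 2b ≤
  -- 2a.
  core : a * (suc a * (2 + a) * Y) ≤ a * (suc b * (2 + b) * Z)
  core = begin
    a * (suc a * (2 + a) * Y)           ≡⟨ lemma₃ a Y ⟩
    a * (2 + a) * (suc a * Y)           ≤⟨ *-monoʳ-≤ (a * (2 + a)) (eulAD-ratio (suc a′) b′ (m≤n⇒m≤1+n (≤-trans (n≤1+n b′) b≤a′))) ⟩
    a * (2 + a) * (b * X)               ≡⟨ lemma₄ a b X ⟩
    (2 + a) * b * (a * X)               ≤⟨ *-monoʳ-≤ ((2 + a) * b) (eulAD-ratio a′ (suc b′) b≤a′) ⟩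
    (2 + a) * b * (suc b * Z)           ≡⟨ cong (_* (suc b * Z)) (lemma₆ a b) ⟩
    (a * b + 2 * b) * (suc b * Z)       ≤⟨ *-monoˡ-≤ (suc b * Z) (+-monoʳ-≤ (a * b) (*-monoʳ-≤ 2 (m≤n⇒m≤1+n b≤a′))) ⟩
    (a * b + 2 * a) * (suc b * Z)       ≡⟨ lemma₅ a b Z ⟩
    a * (suc b * (2 + b) * Z)           ∎

-- gap k b = A(n,b) - A(n,b-1) for the Eulerian numbers of n = 2b+k+1 letters.
gap : ℕ → ℕ → ℕ
gap k       zero    = 1
gap zero    (suc b) = (3 + b) * gap 1 b
gap (suc k) (suc b) = (2 + b) * gap k (suc b) + (4 + (k + b)) * gap (2 + k) b

-- The difference of two neighbouring Eulerian recurrences can be arranged with positive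
-- coefficients, which is the recurrence of `gap`. For k = 0 the term of index k-1 is missing
-- because it would be the difference of two numbers equal by symmetry.
gap-spec : ∀ k b → eulAD (2 + (k + b)) b + gap k (suc b) ≡ eulAD (suc (k + b)) (suc b)
gap-spec zero zero = refl
gap-spec zero b@(suc b′) = begin-equality
  ((2 + b′) * X + (3 + b) * Y) + (3 + b) * g ≡⟨ lemma b X Y g ⟩
  suc b * X + (3 + b) * (Y + g)              ≡⟨ cong (λ z → suc b * X + (3 + b) * z) (gap-spec 1 b′) ⟩
  suc b * X + (3 + b) * X                    ≡⟨ lemma′ b X ⟩
  (2 + b) * X + (2 + b) * X                  ≡⟨ cong (λ z → (2 + b) * z + (2 + b) * X) (eulAD-sym (suc b) b) ⟩
  (2 + b) * eulAD b (suc b) + (2 + b) * X    ∎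
  where
  X = eulAD (suc b) b
  Y = eulAD (2 + b) b′
  g = gap 1 b
  lemma : ∀ b X Y g → (suc b * X + (3 + b) * Y) + (3 + b) * g ≡ suc b * X + (3 + b) * (Y + g)
  lemma = solve-∀
  lemma′ : ∀ b X → suc b * X + (3 + b) * X ≡ (2 + b) * X + (2 + b) * X
  lemma′ = solve-∀
gap-spec (suc k) zero = begin-equality
  1 + (2 * gap k 1 + (4 + (k + 0)) * 1)               ≡⟨ lemma (k + 0) (gap k 1) ⟩
  2 * (1 + gap k 1) + (2 + suc (k + 0)) * 1           ≡⟨ cong (λ z → 2 * z + (2 + suc (k + 0)) * 1) (gap-spec k 0) ⟩
  2 * eulAD (suc (k + 0)) 1 + (2 + suc (k + 0)) * 1   ∎
  where
  lemma : ∀ k g → 1 + (2 * g + (4 + k) * 1) ≡ 2 * (1 + g) + (2 + suc k) * 1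
  lemma = solve-∀
gap-spec (suc k) b@(suc b′) = begin-equality
  ((2 + b′) * X + (4 + (k + b)) * Y) + ((2 + b) * h + (4 + (k + b)) * g)
    ≡⟨ lemma b (k + b) X Y g h ⟩
  (suc b * X + (2 + b) * h) + (4 + (k + b)) * (Y + g)
    ≡⟨ cong (λ z → (suc b * X + (2 + b) * h) + (4 + (k + b)) * z) spec ⟩
  (suc b * X + (2 + b) * h) + (4 + (k + b)) * X
    ≡⟨ lemma′ b (k + b) X h ⟩
  (2 + b) * (X + h) + (3 + (k + b)) * X
    ≡⟨ cong (λ z → (2 + b) * z + (3 + (k + b)) * X) (gap-spec k b) ⟩
  (2 + b) * eulAD (suc (k + b)) (suc b) + (3 + (k + b)) * X ∎
  where
  X = eulAD (2 + (k + b)) b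
  Y = eulAD (3 + (k + b)) b′
  h = gap k (suc b)
  g = gap (2 + k) b
  spec : Y + g ≡ X
  spec = subst (λ z → eulAD (3 + z) b′ + g ≡ eulAD (2 + z) b) (sym (+-suc k b′)) (gap-spec (2 + k) b′)
  lemma : ∀ b m X Y g h → (suc b * X + (4 + m) * Y) + ((2 + b) * h + (4 + m) * g) ≡ (suc b * X + (2 + b) * h) + (4 + m) * (Y + g)
  lemma = solve-∀
  lemma′ : ∀ b m X h → (suc b * X + (2 + b) * h) + (4 + m) * X ≡ (2 + b) * (X + h) + (3 + m) * X
  lemma′ = solve-∀

-- Upper bounds for the growth of Eulerian numbers

gap-suc : ∀ k b → suc b * gap k b ≤ gap (suc k) b
gap-suc k zero    = ≤-refl
gap-suc k (suc b) = m≤m+n _ _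

gap-pos : ∀ k b → 1 ≤ gap k b
gap-pos k       zero    = ≤-refl
gap-pos zero    (suc b) = *-mono-≤ (s≤s {n = 2 + b} z≤n) (gap-pos 1 b)
gap-pos (suc k) (suc b) = ≤-trans (*-mono-≤ (s≤s {n = suc b} z≤n) (gap-pos k (suc b))) (gap-suc k (suc b))

eulAD-suc : ∀ a b → suc b * eulAD a b ≤ eulAD (suc a) b
eulAD-suc a zero    = ≤-refl
eulAD-suc a (suc b) = m≤m+n _ _

bernoulli-suc : ∀ i k → suc i ^ k * (2 + (k + i)) ≤ (2 + i) * (2 + i) ^ k
bernoulli-suc i zero    = ≤-reflexive (*-comm 1 (2 + i))
bernoulli-suc i (suc k) = begin
  suc i * P * (3 + (k + i))             ≤⟨ m≤m+n _ (P * suc k) ⟩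
  suc i * P * (3 + (k + i)) + P * suc k ≡⟨ lemma i k P ⟩
  (2 + i) * (P * (2 + (k + i)))         ≤⟨ *-monoʳ-≤ (2 + i) (bernoulli-suc i k) ⟩
  (2 + i) * ((2 + i) * (2 + i) ^ k)     ∎
  where
  P = suc i ^ k
  lemma : ∀ i k P → suc i * P * (3 + (k + i)) + P * suc k ≡ (2 + i) * (P * (2 + (k + i)))
  lemma = solve-∀

-- Raising k by one multiplies the smaller number by at least i+1, while the first term of the
-- recurrence multiplies the larger by i+2; this gives the factor ((i+2)/(i+1))^k. The second term
-- is paid for by the change from k+1 to k+2. At k = 0 the two numbers agree by symmetry.
eulAD-growth : ∀ i k → eulAD (k + i) (suc i) * suc i ^ k ≤ suc k * ((2 + i) ^ k * eulAD (suc (k + i)) i)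
eulAD-growth i zero = ≤-reflexive (trans (*-identityʳ _) (trans (eulAD-sym i (suc i)) (sym (lemma _))))
  where
  lemma : ∀ x → 1 * (1 * x) ≡ x
  lemma = solve-∀
eulAD-growth i (suc k) = begin
  ((2 + i) * F + (2 + (k + i)) * X) * (suc i * P)
    ≡⟨ lemma₁ i (k + i) F X P ⟩
  (2 + i) * suc i * (F * P) + suc i * X * (P * (2 + (k + i)))
    ≤⟨ +-mono-≤ (*-monoʳ-≤ ((2 + i) * suc i) (eulAD-growth i k)) (*-monoʳ-≤ (suc i * X) (bernoulli-suc i k)) ⟩
  (2 + i) * suc i * (suc k * (Q * X)) + suc i * X * ((2 + i) * Q)
    ≡⟨ lemma₂ i k Q X ⟩
  (2 + k) * ((2 + i) * Q * (suc i * X))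
    ≤⟨ *-monoʳ-≤ (2 + k) (*-monoʳ-≤ ((2 + i) * Q) (eulAD-suc (suc (k + i)) i)) ⟩
  (2 + k) * ((2 + i) * Q * eulAD (2 + (k + i)) i) ∎
  where
  F = eulAD (k + i) (suc i)
  X = eulAD (suc (k + i)) i
  P = suc i ^ k
  Q = (2 + i) ^ k
  lemma₁ : ∀ i m F X P → ((2 + i) * F + (2 + m) * X) * (suc i * P) ≡ (2 + i) * suc i * (F * P) + suc i * X * (P * (2 + m))
  lemma₁ = solve-∀
  lemma₂ : ∀ i k Q X → (2 + i) * suc i * (suc k * (Q * X)) + suc i * X * ((2 + i) * Q) ≡ (2 + k) * ((2 + i) * Q * (suc i * X))
  lemma₂ = solve-∀

-- By `eulAD-ratio` the lower neighbour is at most (b+1)/(k+b+3) of the number, so the difference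
-- retains (k+2)/(k+b+3) of it. This is weakened to k+1 in order to match the factor in
-- `eulAD-growth`.
eulAD≤gap : ∀ k b → suc k * eulAD (2 + (k + b)) (suc b) ≤ (3 + (k + b)) * gap (suc k) (suc b)
eulAD≤gap k b = begin
  suc k * X                         ≡⟨ cong (suc k *_) spec ⟨
  suc k * (Y + D)                   ≤⟨ *-monoˡ-≤ (Y + D) (n≤1+n (suc k)) ⟩
  (2 + k) * (Y + D)                 ≡⟨ *-distribˡ-+ (2 + k) Y D ⟩
  (2 + k) * Y + (2 + k) * D         ≤⟨ +-monoˡ-≤ ((2 + k) * D) ratio ⟩
  suc b * D + (2 + k) * D           ≡⟨ lemma b k D ⟩
  (3 + (k + b)) * D                 ∎
  where
  X = eulAD (2 + (k + b)) (suc b)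
  Y = eulAD (3 + (k + b)) b
  D = gap (suc k) (suc b)
  spec : Y + D ≡ X
  spec = gap-spec (suc k) b
  lemma : ∀ b k D → suc b * D + (2 + k) * D ≡ (3 + (k + b)) * D
  lemma = solve-∀
  lemma′ : ∀ k b Y → (3 + (k + b)) * Y ≡ suc b * Y + (2 + k) * Y
  lemma′ = solve-∀
  ratio : (2 + k) * Y ≤ suc b * D
  ratio = +-cancelˡ-≤ (suc b * Y) _ _ (begin
    suc b * Y + (2 + k) * Y ≡⟨ lemma′ k b Y ⟨
    (3 + (k + b)) * Y       ≤⟨ eulAD-ratio (2 + (k + b)) b (m≤n⇒m≤1+n (m≤n⇒m≤1+n (m≤n+m b k))) ⟩
    suc b * X               ≡⟨ cong (suc b *_) spec ⟨
    suc b * (Y + D)         ≡⟨ *-distribˡ-+ (suc b) Y D ⟩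
    suc b * Y + suc b * D   ∎)

eulAD-gap-growth : ∀ k b → let i = suc b in
  eulAD (k + i) (suc i) * suc i ^ k ≤ (2 + (k + i)) * ((2 + i) ^ k * gap (suc k) i)
eulAD-gap-growth k b = begin
  eulAD (k + i) (suc i) * suc i ^ k             ≤⟨ eulAD-growth i k ⟩
  suc k * (Q * eulAD (suc (k + i)) i)           ≡⟨ lemma (suc k) Q _ ⟩
  Q * (suc k * eulAD (suc (k + i)) i)           ≡⟨ cong (λ z → Q * (suc k * eulAD (suc z) i)) (+-suc k b) ⟩
  Q * (suc k * eulAD (2 + (k + b)) i)           ≤⟨ *-monoʳ-≤ Q (eulAD≤gap k b) ⟩
  Q * ((3 + (k + b)) * gap (suc k) i)           ≡⟨ cong (λ z → Q * ((2 + z) * gap (suc k) i)) (+-suc k b) ⟨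
  Q * ((2 + (k + i)) * gap (suc k) i)           ≡⟨ lemma Q (2 + (k + i)) _ ⟩
  (2 + (k + i)) * (Q * gap (suc k) i)           ∎
  where
  i = suc b
  Q = (2 + i) ^ k
  lemma : ∀ x y z → x * (y * z) ≡ y * (x * z)
  lemma = solve-∀

-- Lower bounds for the gaps of Eulerian numbers

bernoulli : ∀ x y k → x ^ k * (x + k * y) ≤ x * (x + y) ^ k
bernoulli x y zero    = ≤-reflexive (lemma x)
  where
  lemma : ∀ x → 1 * (x + 0) ≡ x * 1
  lemma = solve-∀
bernoulli x y (suc k) = begin
  x * P * (x + suc k * y)                     ≤⟨ m≤m+n _ (P * (k * y * y)) ⟩
  x * P * (x + suc k * y) + P * (k * y * y)   ≡⟨ lemma x y k P ⟩
  (x + y) * (P * (x + k * y))                 ≤⟨ *-monoʳ-≤ (x + y) (bernoulli x y k) ⟩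
  (x + y) * (x * (x + y) ^ k)                 ≡⟨ lemma′ (x + y) x _ ⟩
  x * ((x + y) * (x + y) ^ k)                 ∎
  where
  P = x ^ k
  lemma : ∀ x y k P → x * P * (x + suc k * y) + P * (k * y * y) ≡ (x + y) * (P * (x + k * y))
  lemma = solve-∀
  lemma′ : ∀ x y z → x * (y * z) ≡ y * (x * z)
  lemma′ = solve-∀

^-distribʳ-* : ∀ x y k → (x * y) ^ k ≡ x ^ k * y ^ k
^-distribʳ-* x y zero    = refl
^-distribʳ-* x y (suc k) = trans (cong (x * y *_) (^-distribʳ-* x y k)) (lemma x y (x ^ k) (y ^ k))
  where
  lemma : ∀ x y u v → x * y * (u * v) ≡ x * u * (y * v)
  lemma = solve-∀

-- Equivalent to (1 + 2/(i+1))^i ≤ i+1, whose left side stays below e^2; i = 1 is an equality.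
-- Consecutive instances are compared through (n+1)(n+2) = n(n+3) + 2 and Bernoulli's inequality.
[3+i]^i≤[1+i]^[1+i] : ∀ b → let i = suc b in (3 + i) ^ i ≤ suc i ^ suc i
[3+i]^i≤[1+i]^[1+i] zero    = ≤-refl
[3+i]^i≤[1+i]^[1+i] (suc b) = *-cancelˡ-≤ c {{_}} (*-cancelˡ-≤ (n ^ e) {{m^n≢0 n e}} (begin
  n ^ e * (c * ((3 + n) * (3 + n) ^ e))
    ≡⟨ lemma₁ (n ^ e) c (3 + n) ((3 + n) ^ e) ⟩
  (3 + n) * (n ^ e * (3 + n) ^ e * c)
    ≡⟨ cong₂ (λ y z → (3 + n) * (y * z)) (sym (^-distribʳ-* n (3 + n) e)) (lemma₂ b) ⟩
  (3 + n) * (u ^ e * (u + e * 2))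
    ≤⟨ *-monoʳ-≤ (3 + n) (bernoulli u 2 e) ⟩
  (3 + n) * (u * (u + 2) ^ e)
    ≡⟨ cong (λ z → (3 + n) * (u * z)) (trans (cong (_^ e) (lemma₃ b)) (^-distribʳ-* (suc n) (2 + n) e)) ⟩
  (3 + n) * (u * (suc n ^ e * (2 + n) ^ e))
    ≤⟨ *-monoʳ-≤ (3 + n) (*-monoʳ-≤ u (*-monoʳ-≤ (suc n ^ e) ([3+i]^i≤[1+i]^[1+i] b))) ⟩
  (3 + n) * (u * (suc n ^ e * (n * n ^ e)))
    ≡⟨ lemma₄ n (suc n ^ e) (n ^ e) ⟩
  n ^ e * ((3 + n) * (3 + n) * (n * n) * suc n ^ e)
    ≤⟨ *-monoʳ-≤ (n ^ e) (*-monoˡ-≤ (suc n ^ e) poly) ⟩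
  n ^ e * (suc n * suc n * c * suc n ^ e)
    ≡⟨ cong (n ^ e *_) (lemma₅ (suc n) c (suc n ^ e)) ⟩
  n ^ e * (c * (suc n * (suc n * suc n ^ e))) ∎))
  where
  e = suc b
  n = 2 + b
  -- The factor u + 2e of Bernoulli's inequality, written as a visible successor so that it can be
  -- cancelled.
  c = 12 + (b * b + 9 * b)
  u = n * (3 + n)
  lemma₁ : ∀ x c y z → x * (c * (y * z)) ≡ y * (x * z * c)
  lemma₁ = solve-∀
  lemma₂ : ∀ b → 12 + (b * b + 9 * b) ≡ (2 + b) * (3 + (2 + b)) + suc b * 2
  lemma₂ = solve-∀
  lemma₃ : ∀ b → (2 + b) * (3 + (2 + b)) + 2 ≡ suc (2 + b) * (2 + (2 + b))
  lemma₃ = solve-∀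
  lemma₄ : ∀ n x y → (3 + n) * (n * (3 + n) * (x * (n * y))) ≡ y * ((3 + n) * (3 + n) * (n * n) * x)
  lemma₄ = solve-∀
  lemma₅ : ∀ x c y → x * x * c * y ≡ c * (x * (x * y))
  lemma₅ = solve-∀
  lemma₆ : ∀ b → (3 + (2 + b)) * (3 + (2 + b)) * ((2 + b) * (2 + b)) + (b * b * b + 6 * (b * b) + 13 * b + 8)
               ≡ suc (2 + b) * suc (2 + b) * (12 + (b * b + 9 * b))
  lemma₆ = solve-∀
  poly : (3 + n) * (3 + n) * (n * n) ≤ suc n * suc n * c
  poly = ≤-trans (m≤m+n _ _) (≤-reflexive (lemma₆ b))

-- The factor is (b+2)(b+3) + (b+4)(b+1): the recurrence unfolded, with `gap 2 b` bounded below by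
-- `gap-suc`.
gap-one-suc : ∀ b → (10 + (10 * b + 2 * (b * b))) * gap 1 b ≤ gap 1 (suc b)
gap-one-suc b = begin
  (10 + (10 * b + 2 * (b * b))) * g                  ≡⟨ lemma b g ⟩
  (2 + b) * ((3 + b) * g) + (4 + b) * (suc b * g)    ≤⟨ +-monoʳ-≤ ((2 + b) * ((3 + b) * g)) (*-monoʳ-≤ (4 + b) (gap-suc 1 b)) ⟩
  (2 + b) * ((3 + b) * g) + (4 + b) * gap 2 b        ∎
  where
  g = gap 1 b
  lemma : ∀ b g → (10 + (10 * b + 2 * (b * b))) * g ≡ (2 + b) * ((3 + b) * g) + (4 + b) * (suc b * g)
  lemma = solve-∀

^-ratio : ∀ b x y → let i = suc b in x * suc i ≤ (3 + i) * y → x ^ i ≤ suc i * y ^ i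
^-ratio b x y p = *-cancelʳ-≤ _ _ (suc i ^ i) {{m^n≢0 (suc i) i}} (begin
  x ^ i * suc i ^ i           ≡⟨ ^-distribʳ-* x (suc i) i ⟨
  (x * suc i) ^ i             ≤⟨ ^-monoˡ-≤ i p ⟩
  ((3 + i) * y) ^ i           ≡⟨ ^-distribʳ-* (3 + i) y i ⟩
  (3 + i) ^ i * y ^ i         ≤⟨ *-monoˡ-≤ (y ^ i) ([3+i]^i≤[1+i]^[1+i] b) ⟩
  suc i * suc i ^ i * y ^ i   ≡⟨ lemma (suc i) (suc i ^ i) (y ^ i) ⟩
  suc i * y ^ i * suc i ^ i   ∎)
  where
  i = suc b
  lemma : ∀ x y z → x * y * z ≡ x * z * y
  lemma = solve-∀

-- From i to i+1 the base grows by a factor of at most (i+3)/(i+1), so its i-th power grows by at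
-- most i+1, the new factor of the factorial. The one remaining factor x is below the growth z of
-- the gap.
gap-one-lower : ∀ b → let i = suc b in (suc i * (2 + i) + i) ^ i ≤ i ! * gap 1 i
gap-one-lower zero    = m≤m+n 7 3
gap-one-lower (suc b) = begin
  x * x ^ i                                             ≤⟨ *-monoʳ-≤ x (^-ratio b x y ratio) ⟩
  x * (suc i * y ^ i)                                   ≤⟨ *-monoʳ-≤ x (*-monoʳ-≤ (suc i) (gap-one-lower b)) ⟩
  x * (suc i * (i ! * gap 1 i))                         ≤⟨ *-monoˡ-≤ (suc i * (i ! * gap 1 i)) x≤z ⟩
  z * (suc i * (i ! * gap 1 i))                         ≡⟨ lemma₃ z (suc i) (i !) (gap 1 i) ⟩
  suc i * i ! * (z * gap 1 i)                           ≤⟨ *-monoʳ-≤ (suc i * i !) (gap-one-suc i) ⟩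
  suc i * i ! * gap 1 (suc i)                           ∎
  where
  i = suc b
  x = suc (suc i) * (2 + suc i) + suc i
  y = suc i * (2 + i) + i
  z = 10 + (10 * i + 2 * (i * i))
  lemma₁ : ∀ b → (suc (suc (suc b)) * (2 + suc (suc b)) + suc (suc b)) * suc (suc b) + b
               ≡ (3 + suc b) * (suc (suc b) * (2 + suc b) + suc b)
  lemma₁ = solve-∀
  lemma₂ : ∀ i → (suc (suc i) * (2 + suc i) + suc i) + (i * i + 4 * i + 3) ≡ 10 + (10 * i + 2 * (i * i))
  lemma₂ = solve-∀
  lemma₃ : ∀ z a b c → z * (a * (b * c)) ≡ a * b * (z * c)
  lemma₃ = solve-∀
  ratio : x * suc i ≤ (3 + i) * y
  ratio = ≤-trans (m≤m+n _ b) (≤-reflexive (lemma₁ b))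
  x≤z : x ≤ z
  x≤z = ≤-trans (m≤m+n _ _) (≤-reflexive (lemma₂ i))

-- The base is tailored to `macaulay-eulerian`: it forces (i+1+y) (i+1)^k to exceed it there, and
-- its summand i pays for the passage from i+1+y to y+1. In the induction on k, the i-th power of
-- (i+3)/(i+1) is at most i+1, which is the factor gained by `gap-suc`.
gap-lower : ∀ k b → let i = suc b in
  ((suc i * (2 + (k + i)) + i) * (2 + i) ^ k) ^ i ≤ i ! * gap (suc k) i * (suc i ^ k) ^ i
gap-lower zero b = begin
  ((suc i * (2 + i) + i) * 1) ^ i ≡⟨ cong (_^ i) (*-identityʳ (suc i * (2 + i) + i)) ⟩
  (suc i * (2 + i) + i) ^ i       ≤⟨ gap-one-lower b ⟩
  i ! * gap 1 i                   ≡⟨ *-identityʳ _ ⟨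
  i ! * gap 1 i * 1               ≡⟨ cong (i ! * gap 1 i *_) (^-zeroˡ i) ⟨
  i ! * gap 1 i * 1 ^ i           ∎
  where
  i = suc b
gap-lower (suc k) b = begin
  (v′ * ((2 + i) * Q)) ^ i                          ≤⟨ ^-monoˡ-≤ i step ⟩
  ((3 + i) * (v * Q)) ^ i                           ≡⟨ ^-distribʳ-* (3 + i) (v * Q) i ⟩
  (3 + i) ^ i * (v * Q) ^ i                         ≤⟨ *-mono-≤ ([3+i]^i≤[1+i]^[1+i] b) (gap-lower k b) ⟩
  suc i * suc i ^ i * (i ! * gap (suc k) i * P ^ i) ≡⟨ lemma₂ (suc i) (suc i ^ i) (i !) (gap (suc k) i) (P ^ i) ⟩
  i ! * (suc i * gap (suc k) i) * (suc i ^ i * P ^ i) ≤⟨ *-monoˡ-≤ _ (*-monoʳ-≤ (i !) (gap-suc (suc k) i)) ⟩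
  i ! * gap (2 + k) i * (suc i ^ i * P ^ i)         ≡⟨ cong (i ! * gap (2 + k) i *_) (^-distribʳ-* (suc i) P i) ⟨
  i ! * gap (2 + k) i * (suc i * P) ^ i             ∎
  where
  i = suc b
  v′ = suc i * (2 + (suc k + i)) + i
  v = suc i * (2 + (k + i)) + i
  P = suc i ^ k
  Q = (2 + i) ^ k
  lemma₁ : ∀ k i Q → (suc i * (2 + (suc k + i)) + i) * ((2 + i) * Q) + (suc i * k + i) * Q
                   ≡ (3 + i) * ((suc i * (2 + (k + i)) + i) * Q)
  lemma₁ = solve-∀
  lemma₂ : ∀ a b c d e → a * b * (c * d * e) ≡ c * (a * d) * (b * e)
  lemma₂ = solve-∀
  step : v′ * ((2 + i) * Q) ≤ (3 + i) * (v * Q)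
  step = ≤-trans (m≤m+n _ _) (≤-reflexive (lemma₁ k i Q))

-- Binomial coefficients and Macaulay representations

-- binom i y is the coefficient (i+y choose i).
binom : ℕ → ℕ → ℕ
binom zero    y       = 1
binom (suc i) zero    = 1
binom (suc i) (suc y) = binom i (suc y) + binom (suc i) y

C≡binom : ∀ i y → (i + y) C i ≡ binom i y
C≡binom zero    y       = nC0≡1 y
C≡binom (suc i) zero    = trans (cong (_C suc i) (+-identityʳ (suc i))) (nCn≡1 (suc i))
C≡binom (suc i) (suc y) = trans (sym (nCk+nC[k+1]≡[n+1]C[k+1] (i + suc y) i))
  (cong₂ _+_ (C≡binom i (suc y)) (trans (cong (_C suc i) (+-suc i y)) (C≡binom (suc i) y)))

binom-absorb : ∀ i y → suc i * binom (suc i) y ≡ suc y * binom i (suc y)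
binom-absorb zero    zero    = refl
binom-absorb zero    (suc y) = trans (*-identityˡ _) (cong suc (trans (sym (*-identityˡ _)) (binom-absorb zero y)))
binom-absorb (suc i) zero    = trans (*-identityʳ (2 + i)) (sym (trans (*-identityˡ _)
  (trans (+-comm _ 1) (cong suc (trans (sym (*-identityˡ (binom i 1))) (trans (sym (binom-absorb i 0)) (*-identityʳ (suc i))))))))
binom-absorb (suc i) (suc y) = begin-equality
  (2 + i) * (X + binom (2 + i) y)
    ≡⟨ *-distribˡ-+ (2 + i) X _ ⟩
  (2 + i) * X + (2 + i) * binom (2 + i) y
    ≡⟨ cong ((2 + i) * X +_) (binom-absorb (suc i) y) ⟩
  (2 + i) * X + suc y * X
    ≡⟨ lemma i y X ⟩
  suc i * X + (2 + y) * X
    ≡⟨ cong (_+ (2 + y) * X) (binom-absorb i (suc y)) ⟩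
  (2 + y) * binom i (2 + y) + (2 + y) * X
    ≡⟨ *-distribˡ-+ (2 + y) (binom i (2 + y)) X ⟨
  (2 + y) * (binom i (2 + y) + X) ∎
  where
  X = binom (suc i) (suc y)
  lemma : ∀ i y X → (2 + i) * X + suc y * X ≡ suc i * X + (2 + y) * X
  lemma = solve-∀

binom-≤-^ : ∀ i y → i ! * binom i y ≤ (i + y) ^ i
binom-≤-^ zero    y = ≤-refl
binom-≤-^ (suc i) y = begin
  suc i * i ! * binom (suc i) y   ≡⟨ lemma (suc i) (i !) _ ⟩
  i ! * (suc i * binom (suc i) y) ≡⟨ cong (i ! *_) (binom-absorb i y) ⟩
  i ! * (suc y * binom i (suc y)) ≡⟨ lemma′ (i !) (suc y) _ ⟩
  suc y * (i ! * binom i (suc y)) ≤⟨ *-mono-≤ (s≤s (m≤n+m y i)) (binom-≤-^ i (suc y)) ⟩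
  (suc i + y) * (i + suc y) ^ i   ≡⟨ cong (λ z → (suc i + y) * z ^ i) (+-suc i y) ⟩
  (suc i + y) * (suc i + y) ^ i   ∎
  where
  lemma : ∀ a b c → a * b * c ≡ b * (a * c)
  lemma = solve-∀
  lemma′ : ∀ a b c → a * (b * c) ≡ b * (a * c)
  lemma′ = solve-∀

binom-mono-suc : ∀ i y → binom i y ≤ binom i (suc y)
binom-mono-suc zero    y = ≤-refl
binom-mono-suc (suc i) y = m≤n+m _ _

binom-mono : ∀ i {y z} → y ≤ z → binom i y ≤ binom i z
binom-mono i {y} {z} y≤z = subst (λ w → binom i y ≤ binom i w) (m∸n+n≡m y≤z) (go (z ∸ y))
  where
  go : ∀ d → binom i y ≤ binom i (d + y)
  go zero    = ≤-refl
  go (suc d) = ≤-trans (go d) (binom-mono-suc i (d + y))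

binom-pos : ∀ i y → 1 ≤ binom i y
binom-pos zero    y       = ≤-refl
binom-pos (suc i) zero    = ≤-refl
binom-pos (suc i) (suc y) = m≤n⇒m≤n+o _ (binom-pos i (suc y))

binom-unbounded : ∀ i y → suc y ≤ binom (suc i) y
binom-unbounded i zero    = ≤-refl
binom-unbounded i (suc y) = +-mono-≤ (binom-pos i (suc y)) (binom-unbounded i y)

binom-bracket : ∀ i g → 1 ≤ g → ∃ λ y → binom (suc i) y ≤ g × g < binom (suc i) (suc y)
binom-bracket i g 1≤g = search g (binom-unbounded i g)
  where
  search : ∀ N → g < binom (suc i) N → ∃ λ y → binom (suc i) y ≤ g × g < binom (suc i) (suc y)
  search zero    g<1 = contradiction 1≤g (<⇒≱ g<1)
  search (suc N) g<  with g <? binom (suc i) N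
  ... | yes p = search N p
  ... | no ¬p = N , ≮⇒≥ ¬p , g<

-- The greedy expansion. By Pascal's rule the remainder is less than `binom (suc i) (suc y)` one
-- index lower, which makes the next entry strictly smaller. The leading entry is kept out of the
-- existential so that it stays known.
greedy : ∀ i y g → binom (suc i) y ≤ g → g < binom (suc i) (suc y) →
         Σ (List ℕ) λ as → ValidRep (suc i) (suc i + y ∷ as) × repValue (suc i) (suc i + y ∷ as) ≡ g
greedy i y g lo hi with g ∸ binom (suc i) y in eq
... | zero = [] , (s≤s z≤n , m≤m+n (suc i) y) ,
  trans (+-identityʳ _) (trans (C≡binom (suc i) y) (≤-antisym lo (m∸n≡0⇒m≤n eq)))
-- At index one the binomials are consecutive integers, so there is no remainder.
greedy zero y g lo hi | suc r = contradiction (m≤n⇒m<n∨m≡n lo) λ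
  { (inj₁ lt) → <⇒≱ hi lt
  ; (inj₂ refl) → 1+n≢0 (trans (sym eq) (n∸n≡0 g)) }
greedy (suc i) y g lo hi | r@(suc _) with binom-bracket i r (s≤s z≤n)
... | y′ , lo′ , hi′ with greedy i y′ r lo′ hi′
... | as , valid , value = suc i + y′ ∷ as ,
  (s≤s z≤n , m≤m+n (2 + i) y , s≤s (s≤s (+-monoʳ-≤ i y′≤y)) , valid) ,
  trans (cong₂ _+_ (C≡binom (2 + i) y) value)
    (trans (cong (binom (2 + i) y +_) (sym eq)) (m+[n∸m]≡n lo))
  where
  r<  : r < binom (suc i) (suc y)
  r< = +-cancelʳ-< (binom (2 + i) y) r (binom (suc i) (suc y))
         (subst (_< binom (suc i) (suc y) + binom (2 + i) y) (sym (trans (cong (_+ binom (2 + i) y) (sym eq)) (m∸n+n≡m lo))) hi)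
  y′≤y : y′ ≤ y
  y′≤y with y′ ≤? y
  ... | yes p = p
  ... | no ¬p = contradiction (≤-trans (binom-mono (suc i) (≰⇒> ¬p)) lo′) (<⇒≱ r<)

-- Only the leading binomial of the representation of g is used; the lower terms of its Macaulay
-- power are discarded.
macaulay-intro : ∀ b g m → 1 ≤ g → (∀ y → g < binom (suc b) (suc y) → m ≤ binom (2 + b) y) →
                 MacaulayBound (suc b) g m
macaulay-intro b g m 1≤g bound with binom-bracket b g 1≤g
... | y , lo , hi with greedy b y g lo hi
... | as , valid , value = suc b + y ∷ as , valid , value ,
  ≤-trans (bound y hi) (≤-trans (≤-reflexive (sym (C≡binom (2 + b) y))) (m≤m+n _ _))

-- If g < C(i+y+1, i), then i! g < (i+y+1)^i, and `gap-lower` makes y large. By absorption C(i+y+1,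
-- i+1) is (y+1)/(i+1) times C(i+y+1, i), hence more than g (y+1)/(i+1), and this is enough for the
-- ratio allowed by `eulAD-gap-growth`.
macaulay-eulerian : ∀ k b g m → let i = suc b in
  gap (suc k) i ≤ g → m ≤ eulAD (k + i) (suc i) → MacaulayBound i g m
macaulay-eulerian k b g m D≤g m≤A =
  macaulay-intro b g m (≤-trans (gap-pos (suc k) i) D≤g) λ y hi → ≤-trans m≤A (bound y hi)
  where
  i = suc b
  D = gap (suc k) i
  A = eulAD (k + i) (suc i)
  P = suc i ^ k
  Q = (2 + i) ^ k
  v = suc i * (2 + (k + i)) + i
  lemma₂ : ∀ y i P → (i + suc y) * P ≡ suc y * P + i * P
  lemma₂ = solve-∀
  lemma₃ : ∀ i a P → suc i * P * a ≡ suc i * (a * P)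
  lemma₃ = solve-∀
  lemma₄ : ∀ i a Q D → suc i * (a * (Q * D)) ≡ suc i * a * Q * D
  lemma₄ = solve-∀
  lemma₅ : ∀ y P x → suc y * P * x ≡ P * (suc y * x)
  lemma₅ = solve-∀
  lemma₆ : ∀ i P x → P * (suc i * x) ≡ suc i * P * x
  lemma₆ = solve-∀
  bound : ∀ y → g < binom i (suc y) → A ≤ binom (suc i) y
  bound y hi = *-cancelˡ-≤ (suc i * P) {{m*n≢0 (suc i) P {{_}} {{m^n≢0 (suc i) k}}}} (begin
    suc i * P * A                       ≡⟨ lemma₃ i A P ⟩
    suc i * (A * P)                     ≤⟨ *-monoʳ-≤ (suc i) (eulAD-gap-growth k b) ⟩
    suc i * ((2 + (k + i)) * (Q * D))   ≡⟨ lemma₄ i (2 + (k + i)) Q D ⟩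
    suc i * (2 + (k + i)) * Q * D       ≤⟨ *-mono-≤ base (≤-trans D≤g (<⇒≤ hi)) ⟩
    suc y * P * binom i (suc y)         ≡⟨ lemma₅ y P _ ⟩
    P * (suc y * binom i (suc y))       ≡⟨ cong (P *_) (binom-absorb i y) ⟨
    P * (suc i * binom (suc i) y)       ≡⟨ lemma₆ i P _ ⟩
    suc i * P * binom (suc i) y         ∎)
    where
    powers : (v * Q) ^ i < ((i + suc y) * P) ^ i
    powers = begin-strict
      (v * Q) ^ i                       ≤⟨ gap-lower k b ⟩
      i ! * D * P ^ i                   ≤⟨ *-monoˡ-≤ (P ^ i) (*-monoʳ-≤ (i !) D≤g) ⟩
      i ! * g * P ^ i                   <⟨ *-monoˡ-< (P ^ i) {{m^n≢0 P i {{m^n≢0 (suc i) k}}}} (*-monoʳ-< (i !) {{i !≢0}} hi) ⟩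
      i ! * binom i (suc y) * P ^ i     ≤⟨ *-monoˡ-≤ (P ^ i) (binom-≤-^ i (suc y)) ⟩
      (i + suc y) ^ i * P ^ i           ≡⟨ ^-distribʳ-* (i + suc y) P i ⟨
      ((i + suc y) * P) ^ i             ∎
    vQ< : v * Q < (i + suc y) * P
    vQ< = ≰⇒> λ le → <⇒≱ powers (^-monoˡ-≤ i le)
    base : suc i * (2 + (k + i)) * Q ≤ suc y * P
    base = +-cancelʳ-≤ (i * Q) _ _ (begin
      suc i * (2 + (k + i)) * Q + i * Q ≡⟨ *-distribʳ-+ Q (suc i * (2 + (k + i))) i ⟨
      v * Q                             ≤⟨ <⇒≤ vQ< ⟩
      (i + suc y) * P                   ≡⟨ lemma₂ y i P ⟩
      suc y * P + i * P                 ≤⟨ +-monoʳ-≤ (suc y * P) (*-monoʳ-≤ i (^-monoˡ-≤ k (n≤1+n (suc i)))) ⟩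
      suc y * P + i * Q                 ∎)

-- Finite sums

∑ : ℕ → (ℕ → ℕ) → ℕ
∑ zero    f = 0
∑ (suc j) f = f 0 + ∑ j (f ∘ suc)

∑V : ∀ n → ℕ → (Vec ℕ n → ℕ) → ℕ
∑V zero    j f = f []
∑V (suc n) j f = ∑ j λ c → ∑V n j λ cs → f (c ∷ cs)

∑L : {A : Set} → List A → (A → ℕ) → ℕ
∑L []       f = 0
∑L (x ∷ xs) f = f x + ∑L xs f

∑-cong< : ∀ j {f g : ℕ → ℕ} → (∀ c → c < j → f c ≡ g c) → ∑ j f ≡ ∑ j g
∑-cong< zero    e = refl
∑-cong< (suc j) e = cong₂ _+_ (e 0 z<s) (∑-cong< j λ c c<j → e (suc c) (s<s c<j))

∑-cong : ∀ j {f g : ℕ → ℕ} → f ≗ g → ∑ j f ≡ ∑ j g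
∑-cong j e = ∑-cong< j λ c _ → e c

∑V-cong< : ∀ n j {f g : Vec ℕ n → ℕ} → (∀ cs → All (_< j) cs → f cs ≡ g cs) → ∑V n j f ≡ ∑V n j g
∑V-cong< zero    j e = e [] []
∑V-cong< (suc n) j e = ∑-cong< j λ c c<j → ∑V-cong< n j λ cs p → e (c ∷ cs) (c<j ∷ p)

∑V-cong : ∀ n j {f g : Vec ℕ n → ℕ} → f ≗ g → ∑V n j f ≡ ∑V n j g
∑V-cong n j e = ∑V-cong< n j λ cs _ → e cs

∑L-cong : {A : Set} (xs : List A) {f g : A → ℕ} → f ≗ g → ∑L xs f ≡ ∑L xs g
∑L-cong []       e = refl
∑L-cong (x ∷ xs) e = cong₂ _+_ (e x) (∑L-cong xs e)

∑-zero : ∀ j → ∑ j (λ _ → 0) ≡ 0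
∑-zero zero    = refl
∑-zero (suc j) = ∑-zero j

∑-one : ∀ j → ∑ j (λ _ → 1) ≡ j
∑-one zero    = refl
∑-one (suc j) = cong suc (∑-one j)

∑-+ : ∀ j f g → ∑ j (λ c → f c + g c) ≡ ∑ j f + ∑ j g
∑-+ zero    f g = refl
∑-+ (suc j) f g = trans (cong (f 0 + g 0 +_) (∑-+ j (f ∘ suc) (g ∘ suc)))
                        (interchange (f 0) (g 0) (∑ j (f ∘ suc)) (∑ j (g ∘ suc)))

∑-*ˡ : ∀ j k f → ∑ j (λ c → k * f c) ≡ k * ∑ j f
∑-*ˡ zero    k f = sym (*-zeroʳ k)
∑-*ˡ (suc j) k f = trans (cong (k * f 0 +_) (∑-*ˡ j k (f ∘ suc))) (sym (*-distribˡ-+ k (f 0) _))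

∑-*ʳ : ∀ j k f → ∑ j (λ c → f c * k) ≡ ∑ j f * k
∑-*ʳ j k f = trans (∑-cong j λ c → *-comm (f c) k) (trans (∑-*ˡ j k f) (*-comm k _))

∑-split : ∀ a b f → ∑ (a + b) f ≡ ∑ a f + ∑ b (λ c → f (a + c))
∑-split zero    b f = refl
∑-split (suc a) b f = trans (cong (f 0 +_) (∑-split a b (f ∘ suc))) (sym (+-assoc (f 0) _ _))

∑-swap : ∀ i j (f : ℕ → ℕ → ℕ) → ∑ i (λ a → ∑ j (f a)) ≡ ∑ j (λ b → ∑ i (λ a → f a b))
∑-swap zero    j f = sym (∑-zero j)
∑-swap (suc i) j f = trans (cong (∑ j (f 0) +_) (∑-swap i j (f ∘ suc)))
                           (sym (∑-+ j (f 0) λ b → ∑ i (λ a → f (suc a) b)))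

∑V-zero : ∀ n j → ∑V n j (λ _ → 0) ≡ 0
∑V-zero zero    j = refl
∑V-zero (suc n) j = trans (∑-cong j λ _ → ∑V-zero n j) (∑-zero j)

∑V-+ : ∀ n j f g → ∑V n j (λ c → f c + g c) ≡ ∑V n j f + ∑V n j g
∑V-+ zero    j f g = refl
∑V-+ (suc n) j f g = trans (∑-cong j λ c → ∑V-+ n j (λ cs → f (c ∷ cs)) (λ cs → g (c ∷ cs))) (∑-+ j _ _)

∑V-*ˡ : ∀ n j k f → ∑V n j (λ c → k * f c) ≡ k * ∑V n j f
∑V-*ˡ zero    j k f = refl
∑V-*ˡ (suc n) j k f = trans (∑-cong j λ c → ∑V-*ˡ n j k λ cs → f (c ∷ cs)) (∑-*ˡ j k _)

∑V-*ʳ : ∀ n j k f → ∑V n j (λ c → f c * k) ≡ ∑V n j f * k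
∑V-*ʳ n j k f = trans (∑V-cong n j λ c → *-comm (f c) k) (trans (∑V-*ˡ n j k f) (*-comm k _))

∑V-∑L : ∀ n j {A : Set} (xs : List A) (f : A → Vec ℕ n → ℕ) →
        ∑V n j (λ c → ∑L xs λ x → f x c) ≡ ∑L xs λ x → ∑V n j (f x)
∑V-∑L n j []       f = ∑V-zero n j
∑V-∑L n j (x ∷ xs) f = trans (∑V-+ n j (f x) λ c → ∑L xs λ y → f y c) (cong (∑V n j (f x) +_) (∑V-∑L n j xs f))

∑V-∑ : ∀ n j i (f : ℕ → Vec ℕ n → ℕ) → ∑V n j (λ c → ∑ i λ d → f d c) ≡ ∑ i λ d → ∑V n j (f d)
∑V-∑ n j zero    f = ∑V-zero n j
∑V-∑ n j (suc i) f = trans (∑V-+ n j (f 0) λ c → ∑ i λ d → f (suc d) c) (cong (∑V n j (f 0) +_) (∑V-∑ n j i (f ∘ suc)))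

∑L-++ : {A : Set} (xs ys : List A) (f : A → ℕ) → ∑L (xs ++ ys) f ≡ ∑L xs f + ∑L ys f
∑L-++ []       ys f = refl
∑L-++ (x ∷ xs) ys f = trans (cong (f x +_) (∑L-++ xs ys f)) (sym (+-assoc (f x) _ _))

∑L-map : {A B : Set} (h : A → B) (xs : List A) (f : B → ℕ) → ∑L (mapᴸ h xs) f ≡ ∑L xs (f ∘ h)
∑L-map h []       f = refl
∑L-map h (x ∷ xs) f = cong (f (h x) +_) (∑L-map h xs f)

∑L-*ˡ : {A : Set} (xs : List A) (k : ℕ) (f : A → ℕ) → ∑L xs (λ x → k * f x) ≡ k * ∑L xs f
∑L-*ˡ []       k f = sym (*-zeroʳ k)
∑L-*ˡ (x ∷ xs) k f = trans (cong (k * f x +_) (∑L-*ˡ xs k f)) (sym (*-distribˡ-+ k (f x) _))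

∑V-insertAt : ∀ {n} j (x : Fin (suc n)) (f : Vec ℕ (suc n) → ℕ) →
              ∑V (suc n) j f ≡ ∑ j λ d → ∑V n j λ c → f (insertAt c x d)
∑V-insertAt         j zero    f = refl
∑V-insertAt {suc n} j (suc x) f = trans
  (∑-cong j λ a → ∑V-insertAt j x λ c → f (a ∷ c))
  (∑-swap j j λ a d → ∑V n j λ c → f (a ∷ insertAt c x d))

-- Indicators of order relations

-- Conditions are 0-1 valued numbers, so that counts become sums of products. `ne` is a sum so that
-- it expands over the two directions of an edge.
lt ne : ℕ → ℕ → ℕ
lt a       zero    = 0
lt zero    (suc b) = 1
lt (suc a) (suc b) = lt a b
ne a b = lt a b + lt b a

lt-irrefl : ∀ a → lt a a ≡ 0
lt-irrefl zero    = refl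
lt-irrefl (suc a) = lt-irrefl a

lt-≥ : ∀ {a b} → b ≤ a → lt a b ≡ 0
lt-≥ z≤n     = refl
lt-≥ (s≤s p) = lt-≥ p

lt-< : ∀ {a b} → a < b → lt a b ≡ 1
lt-< {zero}  (s≤s p) = refl
lt-< {suc a} (s≤s p) = lt-< p

lt-+ : ∀ k a b → lt (k + a) (k + b) ≡ lt a b
lt-+ zero    a b = refl
lt-+ (suc k) a b = lt-+ k a b

ne-idem : ∀ a b → ne a b * ne a b ≡ ne a b
ne-idem zero    zero    = refl
ne-idem zero    (suc b) = refl
ne-idem (suc a) zero    = refl
ne-idem (suc a) (suc b) = ne-idem a b

∑-ne : ∀ j c (f : ℕ → ℕ) → c < j → ∑ j (λ d → ne d c * f d) + f c ≡ ∑ j f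
∑-ne (suc j) zero    f _ = trans (+-comm _ (f 0)) (cong (f 0 +_) (∑-cong j λ d → *-identityˡ (f (suc d))))
∑-ne (suc j) (suc c) f (s≤s c<j) = trans (+-assoc (1 * f 0) _ _)
  (cong₂ _+_ (*-identityˡ (f 0)) (∑-ne j c (f ∘ suc) c<j))

punch : ℕ → ℕ → ℕ
punch zero    c       = suc c
punch (suc d) zero    = zero
punch (suc d) (suc c) = suc (punch d c)

lt-punch : ∀ d a b → lt (punch d a) (punch d b) ≡ lt a b
lt-punch zero    a       b       = refl
lt-punch (suc d) zero    zero    = refl
lt-punch (suc d) zero    (suc b) = refl
lt-punch (suc d) (suc a) zero    = refl
lt-punch (suc d) (suc a) (suc b) = lt-punch d a b

∑-punch : ∀ j d (f : ℕ → ℕ) → d < suc j → ∑ (suc j) (λ c → ne d c * f c) ≡ ∑ j (f ∘ punch d)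
∑-punch j       zero    f _ = ∑-cong j λ c → *-identityˡ (f (suc c))
∑-punch (suc j) (suc d) f (s≤s d<) = cong₂ _+_ (*-identityˡ (f 0)) (∑-punch j d (f ∘ suc) d<)

-- Colouring constraints

-- A symmetric system of binary constraints on n vertices, stored as its strictly
-- upper triangle: the row of a vertex lists its constraints with the later ones.
data Str (K : Set) : ℕ → Set where
  []  : Str K 0
  _∷_ : ∀ {n} → Vec K n → Str K n → Str K (suc n)

module Colourings {K : Set} (σ : K → ℕ → ℕ → ℕ) where

  rowSat : ∀ {n} → Vec K n → ℕ → Vec ℕ n → ℕ
  rowSat []      d []       = 1
  rowSat (k ∷ r) d (c ∷ cs) = σ k d c * rowSat r d cs

  sat : ∀ {n} → Str K n → Vec ℕ n → ℕ
  sat []      []       = 1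
  sat (r ∷ s) (c ∷ cs) = rowSat r c cs * sat s cs

  count : ∀ {n} → Str K n → ℕ → ℕ
  count {n} s j = ∑V n j (sat s)

  rowSat-insertAt : ∀ {n} (r : Vec K (suc n)) a c x d →
    rowSat r a (insertAt c x d) ≡ σ (lookup r x) a d * rowSat (removeAt r x) a c
  rowSat-insertAt (k ∷ r) a c zero d = refl
  rowSat-insertAt (k ∷ r@(_ ∷ _)) a (b ∷ c) (suc x) d =
    trans (cong (σ k a b *_) (rowSat-insertAt r a c x d)) (lemma (σ k a b) (σ (lookup r x) a d) _)
    where
    lemma : ∀ x y z → x * (y * z) ≡ y * (x * z)
    lemma = solve-∀

  module Extraction (flip : K → K) (σ-flip : ∀ k a b → σ k a b ≡ σ (flip k) b a) where

    -- Brings x to the front. Its constraints with earlier vertices are stored in the rows of those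
    -- vertices and have to be read backwards, hence `flip`.
    extract : ∀ {n} → Str K (suc n) → Fin (suc n) → Vec K n × Str K n
    extract         (r ∷ s) zero    = r , s
    extract {suc n} (r ∷ s) (suc x) =
      flip (lookup r x) ∷ proj₁ (extract s x) , removeAt r x ∷ proj₂ (extract s x)

    sat-extract : ∀ {n} (s : Str K (suc n)) x d c →
      sat s (insertAt c x d) ≡ rowSat (proj₁ (extract s x)) d c * sat (proj₂ (extract s x)) c
    sat-extract         (r ∷ s) zero    d c       = refl
    sat-extract {suc n} (r ∷ s) (suc x) d (a ∷ c) = trans
      (cong₂ _*_ (trans (rowSat-insertAt r a c x d) (cong (_* rowSat (removeAt r x) a c) (σ-flip (lookup r x) a d)))
                 (sat-extract s x d c))
      (lemma (σ (flip (lookup r x)) d a) (rowSat (removeAt r x) a c) _ _)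
      where
      lemma : ∀ x y z w → (x * y) * (z * w) ≡ (x * z) * (y * w)
      lemma = solve-∀

    count-extract : ∀ {n} (s : Str K (suc n)) x →
      count s ≗ count (proj₁ (extract s x) ∷ proj₂ (extract s x))
    count-extract {n} s x j = trans (∑V-insertAt j x (sat s))
      (∑-cong j λ d → ∑V-cong n j λ c → sat-extract s x d c)

-- Graphs: deletion and contraction

σᴱ : Bool → ℕ → ℕ → ℕ
σᴱ false a b = 1
σᴱ true  a b = ne a b

module E = Colourings σᴱ

rowSat-∪ : ∀ {n} (r r′ : Vec Bool n) d c →
  E.rowSat (zipWith _∨_ r r′) d c ≡ E.rowSat r d c * E.rowSat r′ d c
rowSat-∪ []      []        d []      = refl
rowSat-∪ (k ∷ r) (k′ ∷ r′) d (a ∷ c) = trans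
  (cong₂ _*_ (σ-∨ k k′) (rowSat-∪ r r′ d c)) (lemma (σᴱ k d a) (σᴱ k′ d a) _ _)
  where
  σ-∨ : ∀ k k′ → σᴱ (k ∨ k′) d a ≡ σᴱ k d a * σᴱ k′ d a
  σ-∨ false k′    = sym (*-identityˡ _)
  σ-∨ true  false = sym (*-identityʳ _)
  σ-∨ true  true  = sym (ne-idem d a)
  lemma : ∀ x y z w → (x * y) * (z * w) ≡ (x * z) * (y * w)
  lemma = solve-∀

-- The contractions of the edges r of a new vertex, each edge being deleted
-- before the next one is contracted.
contractions : ∀ {n} → Vec Bool n → Str Bool n → List (Str Bool n)
contractions []          []       = []
contractions (false ∷ r) (r₁ ∷ s) = mapᴸ (r₁ ∷_) (contractions r s)
contractions (true  ∷ r) (r₁ ∷ s) = (zipWith _∨_ r₁ r ∷ s) ∷ mapᴸ (r₁ ∷_) (contractions r s)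

-- A colour d of the new vertex either respects all edges of r or has a last neighbour of colour d.
-- The contraction of the edge to that neighbour, with earlier edges deleted and later ones carried
-- over, counts exactly this case.
contractions-sat : ∀ {n} (r : Vec Bool n) s j c → All (_< j) c →
  ∑ j (λ d → E.rowSat r d c) * E.sat s c + ∑L (contractions r s) (λ t → E.sat t c) ≡ j * E.sat s c
contractions-sat [] [] j [] [] = trans (+-identityʳ _) (cong (_* 1) (∑-one j))
contractions-sat (false ∷ r) (r₁ ∷ s) j (a ∷ c) (a<j ∷ p) = begin-equality
  ∑ j (λ d → 1 * E.rowSat r d c) * (x * y) + ∑L (mapᴸ (r₁ ∷_) cs) (λ t → E.sat t (a ∷ c))
    ≡⟨ cong₂ _+_ (cong (_* (x * y)) (∑-cong j λ d → *-identityˡ (E.rowSat r d c)))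
                 (trans (∑L-map (r₁ ∷_) cs _) (∑L-*ˡ cs x λ t → E.sat t c)) ⟩
  ∑ j (λ d → E.rowSat r d c) * (x * y) + x * ∑L cs (λ t → E.sat t c)
    ≡⟨ lemma₁ x y (∑ j λ d → E.rowSat r d c) _ ⟩
  x * (∑ j (λ d → E.rowSat r d c) * y + ∑L cs (λ t → E.sat t c))
    ≡⟨ cong (x *_) (contractions-sat r s j c p) ⟩
  x * (j * y)
    ≡⟨ lemma₂ x j y ⟩
  j * (x * y) ∎
  where
  cs = contractions r s
  x = E.rowSat r₁ a c
  y = E.sat s c
  lemma₁ : ∀ x y z w → z * (x * y) + x * w ≡ x * (z * y + w)
  lemma₁ = solve-∀
  lemma₂ : ∀ x j y → x * (j * y) ≡ j * (x * y)
  lemma₂ = solve-∀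
contractions-sat (true ∷ r) (r₁ ∷ s) j (a ∷ c) (a<j ∷ p) = begin-equality
  S * (x * y) + (E.rowSat (zipWith _∨_ r₁ r) a c * y + ∑L (mapᴸ (r₁ ∷_) cs) (λ t → E.sat t (a ∷ c)))
    ≡⟨ cong₂ (λ u v → S * (x * y) + (u * y + v)) (rowSat-∪ r₁ r a c) (trans (∑L-map (r₁ ∷_) cs _) (∑L-*ˡ cs x λ t → E.sat t c)) ⟩
  S * (x * y) + ((x * z) * y + x * w)
    ≡⟨ lemma₁ S x y z w ⟩
  x * ((S + z) * y + w)
    ≡⟨ cong (λ u → x * (u * y + w)) (∑-ne j a (λ d → E.rowSat r d c) a<j) ⟩
  x * (∑ j (λ d → E.rowSat r d c) * y + w)
    ≡⟨ cong (x *_) (contractions-sat r s j c p) ⟩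
  x * (j * y)
    ≡⟨ lemma₂ x j y ⟩
  j * (x * y) ∎
  where
  cs = contractions r s
  S = ∑ j (λ d → ne d a * E.rowSat r d c)
  w = ∑L cs (λ t → E.sat t c)
  x = E.rowSat r₁ a c
  y = E.sat s c
  z = E.rowSat r a c
  lemma₁ : ∀ S x y z w → S * (x * y) + ((x * z) * y + x * w) ≡ x * ((S + z) * y + w)
  lemma₁ = solve-∀
  lemma₂ : ∀ x j y → x * (j * y) ≡ j * (x * y)
  lemma₂ = solve-∀

count-contractions : ∀ {n} (r : Vec Bool n) s j →
  E.count (r ∷ s) j + ∑L (contractions r s) (λ t → E.count t j) ≡ j * E.count s j
count-contractions {n} r s j = begin-equality
  ∑ j (λ d → ∑V n j λ c → E.rowSat r d c * E.sat s c) + ∑L cs (λ t → E.count t j)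
    ≡⟨ cong₂ _+_ (trans (sym (∑V-∑ n j j λ d c → E.rowSat r d c * E.sat s c))
                        (∑V-cong n j λ c → ∑-*ʳ j (E.sat s c) λ d → E.rowSat r d c))
                 (sym (∑V-∑L n j cs E.sat)) ⟩
  ∑V n j (λ c → ∑ j (λ d → E.rowSat r d c) * E.sat s c) + ∑V n j (λ c → ∑L cs λ t → E.sat t c)
    ≡⟨ ∑V-+ n j (λ c → ∑ j (λ d → E.rowSat r d c) * E.sat s c) (λ c → ∑L cs λ t → E.sat t c) ⟨
  ∑V n j (λ c → ∑ j (λ d → E.rowSat r d c) * E.sat s c + ∑L cs λ t → E.sat t c)
    ≡⟨ ∑V-cong< n j (λ c p → contractions-sat r s j c p) ⟩
  ∑V n j (λ c → j * E.sat s c)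
    ≡⟨ ∑V-*ˡ n j j (E.sat s) ⟩
  j * E.count s j ∎
  where cs = contractions r s

rowSat-free : ∀ {n} d c → E.rowSat (replicate n false) d c ≡ 1
rowSat-free d []      = refl
rowSat-free d (a ∷ c) = trans (*-identityˡ _) (rowSat-free d c)

count-isolated : ∀ {n} (s : Str Bool n) j → E.count (replicate n false ∷ s) j ≡ j * E.count s j
count-isolated {n} s j = begin-equality
  ∑ j (λ d → ∑V n j λ c → E.rowSat (replicate n false) d c * E.sat s c)
    ≡⟨ ∑-cong j (λ d → ∑V-cong n j λ c → trans (cong (_* E.sat s c) (rowSat-free d c)) (*-identityˡ _)) ⟩
  ∑ j (λ d → E.count s j)
    ≡⟨ ∑-cong j (λ d → sym (*-identityˡ (E.count s j))) ⟩
  ∑ j (λ d → 1 * E.count s j)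
    ≡⟨ trans (∑-*ʳ j (E.count s j) (λ _ → 1)) (cong (_* E.count s j) (∑-one j)) ⟩
  j * E.count s j ∎

-- Graphs whose proper colourings correspond to the improper colourings of the given one.
ears : ∀ {m} → Str Bool (suc m) → List (Str Bool m)
ears {zero}  _       = []
ears {suc m} (r ∷ s) = contractions r s ++ mapᴸ (replicate m false ∷_) (ears s)

-- All edges are deleted in turn until j^(m+1) counts the colourings of the edgeless graph; each
-- deletion leaves one contraction. Once the first vertex is isolated it contributes the factor j,
-- and so it is put back into the ears of the rest.
count-ears : ∀ {m} (s : Str Bool (suc m)) j → E.count s j + ∑L (ears s) (λ t → E.count t j) ≡ j ^ suc m
count-ears {zero}  ([] ∷ []) j = trans (+-identityʳ _) (trans (∑-one j) (sym (*-identityʳ j)))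
count-ears {suc m} (r ∷ s)   j = begin-equality
  E.count (r ∷ s) j + ∑L (contractions r s ++ mapᴸ (replicate m false ∷_) (ears s)) f
    ≡⟨ cong (E.count (r ∷ s) j +_) (∑L-++ (contractions r s) _ f) ⟩
  E.count (r ∷ s) j + (∑L (contractions r s) f + ∑L (mapᴸ (replicate m false ∷_) (ears s)) f)
    ≡⟨ +-assoc (E.count (r ∷ s) j) _ _ ⟨
  (E.count (r ∷ s) j + ∑L (contractions r s) f) + ∑L (mapᴸ (replicate m false ∷_) (ears s)) f
    ≡⟨ cong₂ _+_ (count-contractions r s j)
         (trans (∑L-map (replicate m false ∷_) (ears s) f)
         (trans (∑L-cong (ears s) λ t → count-isolated t j) (∑L-*ˡ (ears s) j λ t → E.count t j))) ⟩
  j * E.count s j + j * ∑L (ears s) (λ t → E.count t j)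
    ≡⟨ *-distribˡ-+ j (E.count s j) _ ⟨
  j * (E.count s j + ∑L (ears s) (λ t → E.count t j))
    ≡⟨ cong (j *_) (count-ears s j) ⟩
  j * j ^ suc m ∎
  where
  f : Str Bool (suc m) → ℕ
  f t = E.count t j

-- Cones over graphs

rowSat-punch : ∀ {n} (r : Vec Bool n) e d c → E.rowSat r (punch e d) (map (punch e) c) ≡ E.rowSat r d c
rowSat-punch []          e d []      = refl
rowSat-punch (false ∷ r) e d (a ∷ c) = cong (1 *_) (rowSat-punch r e d c)
rowSat-punch (true  ∷ r) e d (a ∷ c) =
  cong₂ _*_ (cong₂ _+_ (lt-punch e d a) (lt-punch e a d)) (rowSat-punch r e d c)

sat-punch : ∀ {n} (s : Str Bool n) e c → E.sat s (map (punch e) c) ≡ E.sat s c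
sat-punch []      e []      = refl
sat-punch (r ∷ s) e (a ∷ c) = cong₂ _*_ (rowSat-punch r e a c) (sat-punch s e c)

∑V-punch : ∀ n j d (f : Vec ℕ n → ℕ) → d < suc j →
  ∑V n (suc j) (λ c → E.rowSat (replicate n true) d c * f c) ≡ ∑V n j (f ∘ map (punch d))
∑V-punch zero    j d f _  = *-identityˡ (f [])
∑V-punch (suc n) j d f d< = begin-equality
  ∑ (suc j) (λ a → ∑V n (suc j) λ c → (ne d a * E.rowSat (replicate n true) d c) * f (a ∷ c))
    ≡⟨ ∑-cong (suc j) (λ a → trans (∑V-cong n (suc j) λ c → *-assoc (ne d a) (E.rowSat (replicate n true) d c) (f (a ∷ c))) (∑V-*ˡ n (suc j) (ne d a) _)) ⟩
  ∑ (suc j) (λ a → ne d a * ∑V n (suc j) λ c → E.rowSat (replicate n true) d c * f (a ∷ c))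
    ≡⟨ ∑-cong (suc j) (λ a → cong (ne d a *_) (∑V-punch n j d (λ c → f (a ∷ c)) d<)) ⟩
  ∑ (suc j) (λ a → ne d a * ∑V n j λ c → f (a ∷ map (punch d) c))
    ≡⟨ ∑-punch j d (λ a → ∑V n j λ c → f (a ∷ map (punch d) c)) d< ⟩
  ∑ j (λ a → ∑V n j λ c → f (punch d a ∷ map (punch d) c)) ∎

-- The apex takes any colour d. The others avoid d, and closing the gap at d by `punch` leaves j
-- colours without affecting which colours are distinct.
count-cone : ∀ {n} (s : Str Bool n) j → E.count (replicate n true ∷ s) (suc j) ≡ suc j * E.count s j
count-cone {n} s j = begin-equality
  ∑ (suc j) (λ d → ∑V n (suc j) λ c → E.rowSat (replicate n true) d c * E.sat s c)
    ≡⟨ ∑-cong< (suc j) (λ d d< → trans (∑V-punch n j d (E.sat s) d<)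
         (trans (∑V-cong n j λ c → sat-punch s d c) (sym (*-identityˡ _)))) ⟩
  ∑ (suc j) (λ d → 1 * E.count s j)
    ≡⟨ trans (∑-*ʳ (suc j) (E.count s j) (λ _ → 1)) (cong (_* E.count s j) (∑-one (suc j))) ⟩
  suc j * E.count s j ∎

-- Orientations

data Ori : Set where
  free up down : Ori

σᴼ : Ori → ℕ → ℕ → ℕ
σᴼ free a b = 1
σᴼ up   a b = lt a b
σᴼ down a b = lt b a

flip : Ori → Ori
flip free = free
flip up   = down
flip down = up

σᴼ-flip : ∀ k a b → σᴼ k a b ≡ σᴼ (flip k) b a
σᴼ-flip free a b = refl
σᴼ-flip up   a b = refl
σᴼ-flip down a b = refl

module O = Colourings σᴼ
module OX = O.Extraction flip σᴼ-flip

orientRow : ∀ {n} → Vec Bool n → List (Vec Ori n)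
orientRow []          = [] ∷ []
orientRow (false ∷ r) = mapᴸ (free ∷_) (orientRow r)
orientRow (true  ∷ r) = mapᴸ (up ∷_) (orientRow r) ++ mapᴸ (down ∷_) (orientRow r)

orient : ∀ {n} → Str Bool n → List (Str Ori n)
orient []      = [] ∷ []
orient (r ∷ s) = cartesianProductWith _∷_ (orientRow r) (orient s)

rowSat-orient : ∀ {n} (r : Vec Bool n) d c → E.rowSat r d c ≡ ∑L (orientRow r) λ o → O.rowSat o d c
rowSat-orient []          d []      = refl
rowSat-orient (false ∷ r) d (a ∷ c) = begin-equality
  1 * E.rowSat r d c                                    ≡⟨ cong (1 *_) (rowSat-orient r d c) ⟩
  1 * ∑L (orientRow r) (λ o → O.rowSat o d c)           ≡⟨ ∑L-*ˡ (orientRow r) 1 _ ⟨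
  ∑L (orientRow r) (λ o → 1 * O.rowSat o d c)           ≡⟨ ∑L-map (free ∷_) (orientRow r) _ ⟨
  ∑L (orientRow (false ∷ r)) (λ o → O.rowSat o d (a ∷ c)) ∎
rowSat-orient (true ∷ r) d (a ∷ c) = begin-equality
  (lt d a + lt a d) * E.rowSat r d c
    ≡⟨ *-distribʳ-+ _ (lt d a) (lt a d) ⟩
  lt d a * E.rowSat r d c + lt a d * E.rowSat r d c
    ≡⟨ cong₂ _+_ (part up) (part down) ⟩
  ∑L (mapᴸ (up ∷_) (orientRow r)) F + ∑L (mapᴸ (down ∷_) (orientRow r)) F
    ≡⟨ ∑L-++ (mapᴸ (up ∷_) (orientRow r)) _ F ⟨
  ∑L (orientRow (true ∷ r)) F ∎
  where
  F : Vec Ori _ → ℕ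
  F o = O.rowSat o d (a ∷ c)
  part : ∀ k → σᴼ k d a * E.rowSat r d c ≡ ∑L (mapᴸ (k ∷_) (orientRow r)) F
  part k = trans (cong (σᴼ k d a *_) (rowSat-orient r d c))
    (trans (sym (∑L-*ˡ (orientRow r) (σᴼ k d a) _)) (sym (∑L-map (k ∷_) (orientRow r) F)))

sat-orient : ∀ {n} (s : Str Bool n) c → E.sat s c ≡ ∑L (orient s) λ o → O.sat o c
sat-orient []      []      = refl
sat-orient (r ∷ s) (a ∷ c) = begin-equality
  E.rowSat r a c * E.sat s c
    ≡⟨ cong₂ _*_ (rowSat-orient r a c) (sat-orient s c) ⟩
  ∑L (orientRow r) (λ o → O.rowSat o a c) * ∑L (orient s) (λ o → O.sat o c)
    ≡⟨ product (orientRow r) ⟩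
  ∑L (orient (r ∷ s)) (λ o → O.sat o (a ∷ c)) ∎
  where
  F : Str Ori _ → ℕ
  F o = O.sat o (a ∷ c)
  product : ∀ os → ∑L os (λ o → O.rowSat o a c) * ∑L (orient s) (λ o → O.sat o c)
                 ≡ ∑L (cartesianProductWith _∷_ os (orient s)) F
  product []       = refl
  product (o ∷ os) = begin-equality
    (O.rowSat o a c + ∑L os (λ o → O.rowSat o a c)) * ∑L (orient s) (λ o → O.sat o c)
      ≡⟨ *-distribʳ-+ _ (O.rowSat o a c) _ ⟩
    O.rowSat o a c * ∑L (orient s) (λ o → O.sat o c) + ∑L os (λ o → O.rowSat o a c) * ∑L (orient s) (λ o → O.sat o c)
      ≡⟨ cong₂ _+_ (trans (sym (∑L-*ˡ (orient s) (O.rowSat o a c) λ t → O.sat t c)) (sym (∑L-map (o ∷_) (orient s) F))) (product os) ⟩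
    ∑L (mapᴸ (o ∷_) (orient s)) F + ∑L (cartesianProductWith _∷_ os (orient s)) F
      ≡⟨ ∑L-++ (mapᴸ (o ∷_) (orient s)) _ F ⟨
    ∑L (cartesianProductWith _∷_ (o ∷ os) (orient s)) F ∎

-- A proper colouring directs each edge towards the larger colour, so it satisfies exactly one
-- orientation.
count-orient : ∀ {n} (s : Str Bool n) j → E.count s j ≡ ∑L (orient s) λ o → O.count o j
count-orient {n} s j = trans (∑V-cong n j (sat-orient s)) (∑V-∑L n j (orient s) O.sat)

-- Splitting the vertices into two classes

∑M : ∀ n → (Vec Bool n → ℕ) → ℕ
∑M zero    f = f []
∑M (suc n) f = ∑M n (f ∘ (true ∷_)) + ∑M n (f ∘ (false ∷_))

∑M-cong : ∀ n {f g : Vec Bool n → ℕ} → f ≗ g → ∑M n f ≡ ∑M n g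
∑M-cong zero    e = e []
∑M-cong (suc n) e = cong₂ _+_ (∑M-cong n (e ∘ (true ∷_))) (∑M-cong n (e ∘ (false ∷_)))

∑M-zero : ∀ n → ∑M n (λ _ → 0) ≡ 0
∑M-zero zero    = refl
∑M-zero (suc n) = cong₂ _+_ (∑M-zero n) (∑M-zero n)

∑M-+ : ∀ n f g → ∑M n (λ m → f m + g m) ≡ ∑M n f + ∑M n g
∑M-+ zero    f g = refl
∑M-+ (suc n) f g = trans (cong₂ _+_ (∑M-+ n (f ∘ (true ∷_)) (g ∘ (true ∷_))) (∑M-+ n (f ∘ (false ∷_)) (g ∘ (false ∷_))))
  (interchange (∑M n (f ∘ (true ∷_))) (∑M n (g ∘ (true ∷_))) (∑M n (f ∘ (false ∷_))) (∑M n (g ∘ (false ∷_))))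

∑-∑M : ∀ n j (f : ℕ → Vec Bool n → ℕ) → ∑ j (λ c → ∑M n (f c)) ≡ ∑M n λ m → ∑ j λ c → f c m
∑-∑M n zero    f = sym (∑M-zero n)
∑-∑M n (suc j) f = trans (cong (∑M n (f 0) +_) (∑-∑M n j (f ∘ suc))) (sym (∑M-+ n (f 0) λ m → ∑ j λ c → f (suc c) m))

size : ∀ {n} → Vec Bool n → ℕ
size []          = 0
size (true  ∷ m) = suc (size m)
size (false ∷ m) = size m

complement : ∀ {n} → Vec Bool n → Vec Bool n
complement = map not

size-complement : ∀ {n} (m : Vec Bool n) → size m + size (complement m) ≡ n
size-complement []          = refl
size-complement (true  ∷ m) = cong suc (size-complement m)
size-complement (false ∷ m) = trans (+-suc (size m) _) (cong suc (size-complement m))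

size-≤ : ∀ {n} (m : Vec Bool n) → size m ≤ n
size-≤ m = subst (size m ≤_) (size-complement m) (m≤m+n _ _)

merge : ∀ {n} (m : Vec Bool n) → Vec ℕ (size m) → Vec ℕ (size (complement m)) → Vec ℕ n
merge []          u       v       = []
merge (true  ∷ m) (a ∷ u) v       = a ∷ merge m u v
merge (false ∷ m) u       (a ∷ v) = a ∷ merge m u v

select : ∀ {n} {A : Set} (m : Vec Bool n) → Vec A n → Vec A (size m)
select []          []      = []
select (true  ∷ m) (k ∷ r) = k ∷ select m r
select (false ∷ m) (k ∷ r) = select m r

restrict : ∀ {n} {A : Set} (m : Vec Bool n) → Str A n → Str A (size m)
restrict []          []      = []
restrict (true  ∷ m) (r ∷ s) = select m r ∷ restrict m s
restrict (false ∷ m) (r ∷ s) = restrict m s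

∑V-merge : ∀ n D e (f : Vec ℕ n → ℕ) → ∑V n (D + e) f ≡
  ∑M n λ m → ∑V (size m) D λ u → ∑V (size (complement m)) e λ v → f (merge m u (map (D +_) v))
∑V-merge zero    D e f = refl
∑V-merge (suc n) D e f = begin-equality
  ∑ (D + e) (λ a → ∑V n (D + e) (f ∘ (a ∷_)))
    ≡⟨ ∑-split D e _ ⟩
  ∑ D (λ a → ∑V n (D + e) (f ∘ (a ∷_))) + ∑ e (λ a → ∑V n (D + e) (f ∘ (D + a ∷_)))
    ≡⟨ cong₂ _+_ (trans (∑-cong D λ a → ∑V-merge n D e (f ∘ (a ∷_))) (∑-∑M n D _))
                 (trans (∑-cong e λ a → ∑V-merge n D e (f ∘ (D + a ∷_))) (∑-∑M n e _)) ⟩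
  ∑M n (λ m → ∑ D λ a → ∑V (size m) D λ u → ∑V (size (complement m)) e λ v → f (a ∷ merge m u (map (D +_) v)))
  + ∑M n (λ m → ∑ e λ a → ∑V (size m) D λ u → ∑V (size (complement m)) e λ v → f (D + a ∷ merge m u (map (D +_) v)))
    ≡⟨ cong₂ _+_ refl (∑M-cong n λ m → sym (∑V-∑ (size m) D e _)) ⟩
  ∑M (suc n) (λ m → ∑V (size m) D λ u → ∑V (size (complement m)) e λ v → f (merge m u (map (D +_) v))) ∎

notUp notDown : Ori → ℕ
notUp free = 1
notUp up   = 0
notUp down = 1
notDown free = 1
notDown up   = 1
notDown down = 0

-- Here m is the class of the vertices coloured lower than the others. A row r is
-- compatible with this for a vertex inside m (lowerOK) or outside m (upperOK).
lowerOK upperOK : ∀ {n} → Vec Bool n → Vec Ori n → ℕ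
lowerOK []          []      = 1
lowerOK (true  ∷ m) (k ∷ r) = lowerOK m r
lowerOK (false ∷ m) (k ∷ r) = notDown k * lowerOK m r
upperOK []          []      = 1
upperOK (true  ∷ m) (k ∷ r) = notUp k * upperOK m r
upperOK (false ∷ m) (k ∷ r) = upperOK m r

-- With arrows pointing to the larger colour, the indicator that no arrow enters m from outside. The
-- constraints between the classes then hold for all colours in the two ranges.
downset : ∀ {n} → Vec Bool n → Str Ori n → ℕ
downset []          []      = 1
downset (true  ∷ m) (r ∷ s) = lowerOK m r * downset m s
downset (false ∷ m) (r ∷ s) = upperOK m r * downset m s

swap-* : ∀ x y z → x * (y * z) ≡ y * (x * z)
swap-* = solve-∀

rowSat-lower : ∀ {n} D (m : Vec Bool n) r d u v → d < D →
  O.rowSat r d (merge m u (map (D +_) v)) ≡ lowerOK m r * O.rowSat (select m r) d u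
rowSat-lower D []          []      d []      []      _   = refl
rowSat-lower D (true  ∷ m) (k ∷ r) d (a ∷ u) v       d<D =
  trans (cong (σᴼ k d a *_) (rowSat-lower D m r d u v d<D)) (swap-* (σᴼ k d a) (lowerOK m r) _)
rowSat-lower D (false ∷ m) (k ∷ r) d u       (a ∷ v) d<D =
  trans (cong₂ _*_ (value k) (rowSat-lower D m r d u v d<D)) (sym (*-assoc (notDown k) _ _))
  where
  d<D+a = m≤n⇒m≤n+o a d<D
  value : ∀ k → σᴼ k d (D + a) ≡ notDown k
  value free = refl
  value up   = lt-< d<D+a
  value down = lt-≥ (<⇒≤ d<D+a)

rowSat-upper : ∀ {n} D (m : Vec Bool n) r d u v → All (_< D) u →
  O.rowSat r (D + d) (merge m u (map (D +_) v)) ≡ upperOK m r * O.rowSat (select (complement m) r) d v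
rowSat-upper D []          []      d []      []      _         = refl
rowSat-upper D (true  ∷ m) (k ∷ r) d (a ∷ u) v       (a<D ∷ p) =
  trans (cong₂ _*_ (value k) (rowSat-upper D m r d u v p)) (sym (*-assoc (notUp k) _ _))
  where
  a<D+d = m≤n⇒m≤n+o d a<D
  value : ∀ k → σᴼ k (D + d) a ≡ notUp k
  value free = refl
  value up   = lt-≥ (<⇒≤ a<D+d)
  value down = lt-< a<D+d
rowSat-upper D (false ∷ m) (k ∷ r) d u       (a ∷ v) p =
  trans (cong₂ _*_ (value k) (rowSat-upper D m r d u v p)) (swap-* (σᴼ k d a) (upperOK m r) _)
  where
  value : ∀ k → σᴼ k (D + d) (D + a) ≡ σᴼ k d a
  value free = refl
  value up   = lt-+ D d a
  value down = lt-+ D a d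

sat-merge : ∀ {n} D (m : Vec Bool n) s u v → All (_< D) u →
  O.sat s (merge m u (map (D +_) v)) ≡ downset m s * (O.sat (restrict m s) u * O.sat (restrict (complement m) s) v)
sat-merge D []          []      []      []      _         = refl
sat-merge D (true  ∷ m) (r ∷ s) (a ∷ u) v       (a<D ∷ p) = trans
  (cong₂ _*_ (rowSat-lower D m r a u v a<D) (sat-merge D m s u v p))
  (lemma (lowerOK m r) (O.rowSat (select m r) a u) (downset m s) _ _)
  where
  lemma : ∀ x y z a b → (x * y) * (z * (a * b)) ≡ (x * z) * ((y * a) * b)
  lemma = solve-∀
sat-merge D (false ∷ m) (r ∷ s) u       (a ∷ v) p         = trans
  (cong₂ _*_ (rowSat-upper D m r a u v p) (sat-merge D m s u v p))
  (lemma (upperOK m r) (O.rowSat (select (complement m) r) a v) (downset m s) (O.sat (restrict m s) u) _)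
  where
  lemma : ∀ x y z a b → (x * y) * (z * (a * b)) ≡ (x * z) * (a * (y * b))
  lemma = solve-∀

Minimal : ∀ {n} → Vec Ori n → Set
Minimal = All (_≢ down)

-- Individual colours do not matter here: a colour at most d violates an `up` constraint, and a
-- colour above d satisfies it.
rowSat-minimal : ∀ {n} (m : Vec Bool n) r d u v → Minimal r → All (_< suc d) u →
  O.rowSat r d (merge m u (map (suc d +_) v)) ≡ upperOK m r
rowSat-minimal []          []      d []      []      _        _         = refl
rowSat-minimal (true  ∷ m) (k ∷ r) d (a ∷ u) v       (k≢ ∷ q) (a≤d ∷ p) =
  cong₂ _*_ (value k k≢) (rowSat-minimal m r d u v q p)
  where
  value : ∀ k → k ≢ down → σᴼ k d a ≡ notUp k
  value free _ = refl
  value up   _ = lt-≥ (≤-pred a≤d)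
  value down k≢ with k≢ refl
  ... | ()
rowSat-minimal (false ∷ m) (k ∷ r) d u       (a ∷ v) (k≢ ∷ q) p =
  trans (cong₂ _*_ (value k k≢) (rowSat-minimal m r d u v q p)) (*-identityˡ _)
  where
  value : ∀ k → k ≢ down → σᴼ k d (suc d + a) ≡ 1
  value free _ = refl
  value up   _ = lt-< (m≤m+n (suc d) a)
  value down k≢ with k≢ refl
  ... | ()

∑-⊛ : ∀ f g j → ∑ (suc j) (λ d → f d * g (j ∸ d)) ≡ (f ⊛ g) j
∑-⊛ f g zero    = +-identityʳ _
∑-⊛ f g (suc j) = cong (f 0 * g (suc j) +_) (∑-⊛ (tail f) g j)

-- Of j+1 colours, d+1 are open to the lower class and j-d to the upper one; hence the `tail` of the
-- first factor and the outer `shift`.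
summand : ∀ {n} → Vec Ori n → Str Ori n → Vec Bool n → Series
summand r s m = scale (upperOK m r * downset m s)
  (shift (tail (O.count (restrict m s)) ⊛ O.count (restrict (complement m) s)))

-- Split the colourings by the colour d of a minimal vertex and the class m of the
-- other vertices with colour at most d.
count-minimal : ∀ {n} (r : Vec Ori n) s → Minimal r →
  O.count (r ∷ s) ≗ λ j → ∑M n λ m → summand r s m j
count-minimal {n} r s min zero    = sym (trans (∑M-cong n λ m → *-zeroʳ (upperOK m r * downset m s)) (∑M-zero n))
count-minimal {n} r s min (suc j) = begin-equality
  ∑ (suc j) (λ d → ∑V n (suc j) λ c → O.rowSat r d c * O.sat s c)
    ≡⟨ ∑-cong< (suc j) (λ d d< → begin-equality
         ∑V n (suc j) (F d)               ≡⟨ cong (λ z → ∑V n z (F d)) (m+[n∸m]≡n d<) ⟨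
         ∑V n (suc d + (j ∸ d)) (F d)     ≡⟨ ∑V-merge n (suc d) (j ∸ d) (F d) ⟩
         _                                ≡⟨ ∑M-cong n (inner d) ⟩
         ∑M n (λ m → G d m)               ∎) ⟩
  ∑ (suc j) (λ d → ∑M n λ m → w m * (tail (A m) d * B m (j ∸ d)))
    ≡⟨ ∑-∑M n (suc j) G ⟩
  ∑M n (λ m → ∑ (suc j) λ d → w m * (tail (A m) d * B m (j ∸ d)))
    ≡⟨ ∑M-cong n (λ m → trans (∑-*ˡ (suc j) (w m) λ d → tail (A m) d * B m (j ∸ d)) (cong (w m *_) (∑-⊛ (tail (A m)) (B m) j))) ⟩
  ∑M n (λ m → w m * (tail (A m) ⊛ B m) j) ∎
  where
  w : Vec Bool n → ℕ
  w m = upperOK m r * downset m s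
  A B : Vec Bool n → Series
  A m = O.count (restrict m s)
  B m = O.count (restrict (complement m) s)
  F : ℕ → Vec ℕ n → ℕ
  F d c = O.rowSat r d c * O.sat s c
  G : ℕ → Vec Bool n → ℕ
  G d m = w m * (tail (A m) d * B m (j ∸ d))
  inner : ∀ d m → (∑V (size m) (suc d) λ u → ∑V (size (complement m)) (j ∸ d) λ v →
    O.rowSat r d (merge m u (map (suc d +_) v)) * O.sat s (merge m u (map (suc d +_) v)))
    ≡ w m * (A m (suc d) * B m (j ∸ d))
  inner d m = begin-equality
    (∑V (size m) (suc d) λ u → ∑V (size (complement m)) (j ∸ d) λ v →
      O.rowSat r d (merge m u (map (suc d +_) v)) * O.sat s (merge m u (map (suc d +_) v)))
      ≡⟨ ∑V-cong< (size m) (suc d) (λ u p → ∑V-cong (size (complement m)) (j ∸ d) λ v →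
           trans (cong₂ _*_ (rowSat-minimal m r d u v min p) (sat-merge (suc d) m s u v p))
                 (lemma (upperOK m r) (downset m s) (O.sat (restrict m s) u) _)) ⟩
    (∑V (size m) (suc d) λ u → ∑V (size (complement m)) (j ∸ d) λ v →
      (w m * O.sat (restrict m s) u) * O.sat (restrict (complement m) s) v)
      ≡⟨ ∑V-cong (size m) (suc d) (λ u → ∑V-*ˡ (size (complement m)) (j ∸ d) (w m * O.sat (restrict m s) u) _) ⟩
    (∑V (size m) (suc d) λ u → (w m * O.sat (restrict m s) u) * B m (j ∸ d))
      ≡⟨ ∑V-*ʳ (size m) (suc d) (B m (j ∸ d)) _ ⟩
    (∑V (size m) (suc d) λ u → w m * O.sat (restrict m s) u) * B m (j ∸ d)
      ≡⟨ cong (_* B m (j ∸ d)) (∑V-*ˡ (size m) (suc d) (w m) _) ⟩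
    (w m * A m (suc d)) * B m (j ∸ d)
      ≡⟨ *-assoc (w m) _ _ ⟩
    w m * (A m (suc d) * B m (j ∸ d)) ∎
    where
    lemma : ∀ x y a b → x * (y * (a * b)) ≡ ((x * y) * a) * b
    lemma = solve-∀

-- Chromatic series lie in the cone

Good-scale : ∀ {p f} k → Good p f → Good p (scale k f)
Good-scale zero    g = Good-𝟘
Good-scale (suc k) g = Good-⊕ g (Good-scale k g)

Good-∑L : ∀ {p} {A : Set} (xs : List A) (F : A → Series) → (∀ x → Good p (F x)) → Good p (λ j → ∑L xs λ x → F x j)
Good-∑L []       F g = Good-𝟘
Good-∑L (x ∷ xs) F g = Good-⊕ (g x) (Good-∑L xs F g)

Good-∑M : ∀ {p} n (F : Vec Bool n → Series) → (∀ m → Good p (F m)) → Good p (λ j → ∑M n λ m → F m j)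
Good-∑M zero    F g = g []
Good-∑M (suc n) F g = Good-⊕ (Good-∑M n _ (g ∘ (true ∷_))) (Good-∑M n _ (g ∘ (false ∷_)))

allMask : Bool → ∀ n → Vec Bool n
allMask b n = replicate n b

-- The sum over all masks but the constant mask b.
∑≢ : Bool → ∀ n → (Vec Bool n → ℕ) → ℕ
∑≢ b     zero    f = 0
∑≢ true  (suc n) f = ∑≢ true n (f ∘ (true ∷_)) + ∑M n (f ∘ (false ∷_))
∑≢ false (suc n) f = ∑M n (f ∘ (true ∷_)) + ∑≢ false n (f ∘ (false ∷_))

∑M-∑≢ : ∀ b n (f : Vec Bool n → ℕ) → ∑M n f ≡ f (allMask b n) + ∑≢ b n f
∑M-∑≢ b     zero    f = sym (+-identityʳ _)
∑M-∑≢ true  (suc n) f = trans (cong (_+ ∑M n (f ∘ (false ∷_))) (∑M-∑≢ true n (f ∘ (true ∷_)))) (+-assoc (f _) _ _)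
∑M-∑≢ false (suc n) f = trans (cong (∑M n (f ∘ (true ∷_)) +_) (∑M-∑≢ false n (f ∘ (false ∷_))))
  (trans (sym (+-assoc (∑M n (f ∘ (true ∷_))) (f _) _))
  (trans (cong (_+ ∑≢ false n (f ∘ (false ∷_))) (+-comm (∑M n (f ∘ (true ∷_))) (f _))) (+-assoc (f _) _ _)))

Good-∑≢true : ∀ {p} n (F : Vec Bool n → Series) → (∀ m → 1 ≤ size (complement m) → Good p (F m)) →
              Good p (λ j → ∑≢ true n λ m → F m j)
Good-∑≢true zero    F g = Good-𝟘
Good-∑≢true (suc n) F g = Good-⊕ (Good-∑≢true n _ λ m → g (true ∷ m)) (Good-∑M n _ λ m → g (false ∷ m) (s≤s z≤n))

Good-∑≢false : ∀ {p} n (F : Vec Bool n → Series) → (∀ m → 1 ≤ size m → Good p (F m)) →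
               Good p (λ j → ∑≢ false n λ m → F m j)
Good-∑≢false zero    F g = Good-𝟘
Good-∑≢false (suc n) F g = Good-⊕ (Good-∑M n _ λ m → g (true ∷ m) (s≤s z≤n)) (Good-∑≢false n _ λ m → g (false ∷ m))

ones : Series
ones _ = 1

sums-δ : sums δ ≗ ones
sums-δ zero    = refl
sums-δ (suc j) = trans (+-identityʳ _) (sums-δ j)

⊛-identityʳ : ∀ f → f ⊛ δ ≗ f
⊛-identityʳ f zero    = *-identityʳ (f 0)
⊛-identityʳ f (suc j) = trans (cong (_+ (tail f ⊛ δ) j) (*-zeroʳ (f 0))) (⊛-identityʳ (tail f) j)

⊛-onesʳ : ∀ f → f ⊛ ones ≗ sums f
⊛-onesʳ f i = trans (⊛-cong {f = f} (λ _ → refl) (λ j → sym (sums-δ j)) i)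
  (trans (⊛-sumsʳ f δ i) (sums-cong (⊛-identityʳ f) i))

⊛-onesˡ : ∀ f → ones ⊛ f ≗ sums f
⊛-onesˡ f i = trans (⊛-cong (λ j → sym (sums-δ j)) (λ _ → refl) i)
  (trans (⊛-sumsˡ δ f i) (sums-cong (⊛-identityˡ f) i))

shift-tail-⊛ : ∀ f g → f 0 ≡ 0 → shift (tail f ⊛ g) ≗ f ⊛ g
shift-tail-⊛ f g z zero    = sym (cong (_* g 0) z)
shift-tail-⊛ f g z (suc j) = sym (cong (λ x → x * g (suc j) + (tail f ⊛ g) j) z)

count-pos-zero : ∀ {n} (s : Str Ori n) → 1 ≤ n → O.count s 0 ≡ 0
count-pos-zero (r ∷ s) _ = refl

count-size-zero : ∀ {n} (s : Str Ori n) → n ≡ 0 → O.count s ≗ ones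
count-size-zero [] _ j = refl

size-true : ∀ n → size (allMask true n) ≡ n
size-true zero    = refl
size-true (suc n) = cong suc (size-true n)

size-false : ∀ n → size (allMask false n) ≡ 0
size-false zero    = refl
size-false (suc n) = size-false n

complement-all : ∀ b n → complement (allMask b n) ≡ allMask (not b) n
complement-all b n = map-replicate not b n

Bit : ℕ → Set
Bit x = x ≡ 0 ⊎ x ≡ 1

Bit-* : ∀ {x y} → Bit x → Bit y → Bit (x * y)
Bit-* (inj₁ refl) _           = inj₁ refl
Bit-* (inj₂ refl) (inj₁ refl) = inj₁ refl
Bit-* (inj₂ refl) (inj₂ refl) = inj₂ refl

Bit-upperOK : ∀ {n} (m : Vec Bool n) r → Bit (upperOK m r)
Bit-upperOK []          []      = inj₂ refl
Bit-upperOK (true  ∷ m) (k ∷ r) = Bit-* (bit k) (Bit-upperOK m r)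
  where
  bit : ∀ k → Bit (notUp k)
  bit free = inj₂ refl
  bit up   = inj₁ refl
  bit down = inj₂ refl
Bit-upperOK (false ∷ m) (k ∷ r) = Bit-upperOK m r

upperOK-false : ∀ {n} (r : Vec Ori n) → upperOK (allMask false n) r ≡ 1
upperOK-false []      = refl
upperOK-false (k ∷ r) = upperOK-false r

lowerOK-true : ∀ {n} (r : Vec Ori n) → lowerOK (allMask true n) r ≡ 1
lowerOK-true []      = refl
lowerOK-true (k ∷ r) = lowerOK-true r

downset-all : ∀ b {n} (s : Str Ori n) → downset (allMask b n) s ≡ 1
downset-all b     []      = refl
downset-all true  (r ∷ s) = cong₂ _*_ (lowerOK-true r) (downset-all true s)
downset-all false (r ∷ s) = cong₂ _*_ (upperOK-false r) (downset-all false s)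

count-one : ∀ {r : Vec Ori 0} {s : Str Ori 0} → O.count (r ∷ s) ≗ iter sums 2 (mono 1 0)
count-one {[]} {[]} j = trans (∑-one j) (sym (lemma j))
  where
  lemma : ∀ j → iter sums 2 (shift δ) j ≡ j
  lemma zero    = refl
  lemma (suc j) = trans (cong₂ _+_ (lemma j) (trans (sums-shift δ (suc j)) (sums-δ j))) (+-comm j 1)

Good-minimal : ∀ {n} (r : Vec Ori n) (s : Str Ori n) → Minimal r →
  (∀ {k} (t : Str Ori k) → 1 ≤ k → k ≤ n → Good k (O.count t)) → Good (suc n) (O.count (r ∷ s))
-- The series of j is t / (1-t)^2, and t meets the bound with equality.
Good-minimal {zero}  r s min ih = mono 1 0 , gen 1 0 ≤-refl , count-one {r} {s}
Good-minimal {suc n} r s min ih =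
  Good-resp (λ j → sym (trans (count-minimal r s min j) (total j))) (Good-⊕ extremes interior)
  where
  N = suc n
  F = summand r s
  X : Series
  X = O.count (restrict (allMask true N) s)
  goodX : Good N X
  goodX = subst (λ k → Good k X) (size-true N)
    (ih (restrict (allMask true N) s) (subst (1 ≤_) (sym (size-true N)) (s≤s z≤n)) (size-≤ (allMask true N)))
  -- The full set is admissible only if x has no `up` constraint; so this weight is 0 or 1.
  wT = upperOK (allMask true N) r * downset (allMask true N) s

  F-true : F (allMask true N) ≗ scale wT (sums X)
  F-true j = cong (wT *_) (begin-equality
    shift (tail X ⊛ O.count (restrict (complement (allMask true N)) s)) j
      ≡⟨ cong (λ m → shift (tail X ⊛ O.count (restrict m s)) j) (complement-all true N) ⟩
    shift (tail X ⊛ O.count (restrict (allMask false N) s)) j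
      ≡⟨ shift-cong (⊛-cong {f = tail X} (λ _ → refl) (count-size-zero (restrict (allMask false N) s) (size-false N))) j ⟩
    shift (tail X ⊛ ones) j
      ≡⟨ shift-tail-⊛ X ones refl j ⟩
    (X ⊛ ones) j
      ≡⟨ ⊛-onesʳ X j ⟩
    sums X j ∎)

  F-false : F (allMask false N) ≗ shift (sums X)
  F-false j = trans (cong₂ _*_ (cong₂ _*_ (upperOK-false r) (downset-all false s)) eq) (*-identityˡ _)
    where
    eq : shift (tail (O.count (restrict (allMask false N) s)) ⊛ O.count (restrict (complement (allMask false N)) s)) j ≡ shift (sums X) j
    eq = begin-equality
      shift (tail (O.count (restrict (allMask false N) s)) ⊛ O.count (restrict (complement (allMask false N)) s)) j
        ≡⟨ cong (λ m → shift (tail (O.count (restrict (allMask false N) s)) ⊛ O.count (restrict m s)) j) (complement-all false N) ⟩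
      shift (tail (O.count (restrict (allMask false N) s)) ⊛ X) j
        ≡⟨ shift-cong (⊛-cong (λ i → count-size-zero (restrict (allMask false N) s) (size-false N) (suc i)) (λ _ → refl)) j ⟩
      shift (ones ⊛ X) j
        ≡⟨ shift-cong (⊛-onesˡ X) j ⟩
      shift (sums X) j ∎

  extremes : Good (suc N) (F (allMask true N) ⊕ F (allMask false N))
  extremes = Good-resp (λ j → sym (cong₂ _+_ (F-true j) (F-false j)))
    (case (Bit-* (Bit-upperOK (allMask true N) r) (inj₂ (downset-all true s))))
    where
    case : Bit wT → Good (suc N) (scale wT (sums X) ⊕ shift (sums X))
    case (inj₁ z) = Good-resp (λ j → cong (λ w → w * sums X j + shift (sums X) j) (sym z)) (Good-shift-sums goodX)
    case (inj₂ o) = Good-resp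
      (λ j → cong (_+ shift (sums X) j) (sym (trans (cong (_* sums X j) o) (*-identityˡ _)))) (Good-1+t-sums goodX)

  Good-summand : ∀ m → 1 ≤ size m → 1 ≤ size (complement m) → Good (suc N) (F m)
  Good-summand m p q = Good-scale (upperOK m r * downset m s)
    (Good-resp (λ j → sym (shift-tail-⊛ A B (count-pos-zero (restrict m s) p) j))
      (subst (λ k → Good (suc k) (A ⊛ B)) (size-complement m)
        (Good-⊛ (ih (restrict m s) p (size-≤ m)) (ih (restrict (complement m) s) q (size-≤ (complement m))))))
    where
    A B : Series
    A = O.count (restrict m s)
    B = O.count (restrict (complement m) s)

  interior : Good (suc N) ((λ j → ∑≢ true n λ m → F (true ∷ m) j) ⊕ (λ j → ∑≢ false n λ m → F (false ∷ m) j))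
  interior = Good-⊕
    -- The first bit makes one class nonempty, and the exclusion of the constant mask on the
    -- remaining bits makes the other nonempty.
    (Good-∑≢true n _ λ m q → Good-summand (true ∷ m) (s≤s z≤n) q)
    (Good-∑≢false n _ λ m p → Good-summand (false ∷ m) p (s≤s z≤n))

  total : ∀ j → (∑M N λ m → F m j) ≡ (F (allMask true N) j + F (allMask false N) j)
    + ((∑≢ true n λ m → F (true ∷ m) j) + (∑≢ false n λ m → F (false ∷ m) j))
  total j = trans (cong₂ _+_ (∑M-∑≢ true n λ m → F (true ∷ m) j) (∑M-∑≢ false n λ m → F (false ∷ m) j))
    (interchange (F (allMask true N) j) _ _ _)

-- A `down` constraint demands a strictly smaller colour elsewhere, which a vertex of least colour
-- cannot provide.
minimal-or-zero : ∀ {n} (r : Vec Ori n) →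
  Minimal r ⊎ (∀ d c → All (d ≤_) c → O.rowSat r d c ≡ 0)
minimal-or-zero []         = inj₁ []
minimal-or-zero (down ∷ r) = inj₂ λ { d (a ∷ c) (d≤a ∷ _) → cong (_* O.rowSat r d c) (lt-≥ d≤a) }
minimal-or-zero (free ∷ r) with minimal-or-zero r
... | inj₁ m = inj₁ ((λ ()) ∷ m)
... | inj₂ z = inj₂ λ { d (a ∷ c) (_ ∷ p) → cong (1 *_) (z d c p) }
minimal-or-zero (up ∷ r) with minimal-or-zero r
... | inj₁ m = inj₁ ((λ ()) ∷ m)
... | inj₂ z = inj₂ λ { d (a ∷ c) (_ ∷ p) → trans (cong (lt d a *_) (z d c p)) (*-zeroʳ (lt d a)) }

search : ∀ {n} {P Q : Fin n → Set} → (∀ x → P x ⊎ Q x) → ∃ P ⊎ (∀ x → Q x)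
search {zero}  d = inj₂ λ ()
search {suc n} d with d zero | search (d ∘ suc)
... | inj₁ p | _            = inj₁ (zero , p)
... | inj₂ q | inj₁ (x , p) = inj₁ (suc x , p)
... | inj₂ q | inj₂ qs      = inj₂ λ { zero → q ; (suc x) → qs x }

All-insertAt : ∀ {n} {P : ℕ → Set} {c : Vec ℕ n} (x : Fin (suc n)) {d} → P d → All P c → All P (insertAt c x d)
All-insertAt zero    p ps       = p ∷ ps
All-insertAt (suc x) p (q ∷ ps) = q ∷ All-insertAt x p ps

argmin : ∀ {n} (c : Vec ℕ (suc n)) → ∃ λ x → ∃ λ d → ∃ λ c′ → c ≡ insertAt c′ x d × All (d ≤_) c′
argmin (a ∷ []) = zero , a , [] , refl , []
argmin (a ∷ c@(_ ∷ _)) with argmin c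
... | x , d , c′ , eq , p with a ≤? d
... | yes a≤d = zero , a , c , refl , subst (All (a ≤_)) (sym eq) (All-insertAt x a≤d (All.map (≤-trans a≤d) p))
... | no  a≰d = suc x , d , a ∷ c′ , cong (a ∷_) eq , <⇒≤ (≰⇒> a≰d) ∷ p

-- Cycles need not be detected: if every vertex has a `down` constraint, a vertex of least colour
-- refutes each colouring and the series is zero. The bound `N` carries the recursion because the
-- classes can have any smaller size.
Good-oriented : ∀ N {k} (s : Str Ori k) → 1 ≤ k → k ≤ N → Good k (O.count s)
Good-oriented (suc N) {suc n} s _ (s≤s n≤N) with search (λ x → minimal-or-zero (proj₁ (OX.extract s x)))
... | inj₁ (x , min) = Good-resp (λ j → sym (OX.count-extract s x j))
  (Good-minimal _ (proj₂ (OX.extract s x)) min λ t p q → Good-oriented N t p (≤-trans q n≤N))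
... | inj₂ zs = Good-resp (λ j → sym (trans (∑V-cong (suc n) j vanish) (∑V-zero (suc n) j))) Good-𝟘
  where
  vanish : ∀ c → O.sat s c ≡ 0
  vanish c with argmin c
  ... | x , d , c′ , refl , p = trans (OX.sat-extract s x d c′) (cong (_* O.sat (proj₂ (OX.extract s x)) c′) (zs x d c′ p))

Good-count : ∀ {n} (s : Str Bool (suc n)) → Good (suc n) (E.count s)
Good-count {n} s = Good-resp (λ j → sym (count-orient s j))
  (Good-∑L (orient s) O.count λ o → Good-oriented (suc n) o (s≤s z≤n) ≤-refl)

-- Chromatic polynomials as counts

toStr : ∀ {n} → (Fin n → Fin n → Bool) → Str Bool n
toStr {zero}  a = []
toStr {suc n} a = tabulate (λ j → a zero (suc j)) ∷ toStr (λ i j → a (suc i) (suc j))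

bit : Bool → ℕ
bit b = if b then 1 else 0

∏F : ∀ n → (Fin n → ℕ) → ℕ
∏F zero    f = 1
∏F (suc n) f = f zero * ∏F n (f ∘ suc)

∏F-cong : ∀ n {f g : Fin n → ℕ} → f ≗ g → ∏F n f ≡ ∏F n g
∏F-cong zero    e = refl
∏F-cong (suc n) e = cong₂ _*_ (e zero) (∏F-cong n (e ∘ suc))

∏F-* : ∀ n f g → ∏F n (λ i → f i * g i) ≡ ∏F n f * ∏F n g
∏F-* zero    f g = refl
∏F-* (suc n) f g = trans (cong (f zero * g zero *_) (∏F-* n (f ∘ suc) (g ∘ suc))) (lemma (f zero) (g zero) _ _)
  where
  lemma : ∀ x y z w → (x * y) * (z * w) ≡ (x * z) * (y * w)
  lemma = solve-∀

bit-and-++ : ∀ xs ys → bit (and (xs ++ ys)) ≡ bit (and xs) * bit (and ys)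
bit-and-++ []           ys = sym (*-identityˡ _)
bit-and-++ (true  ∷ xs) ys = bit-and-++ xs ys
bit-and-++ (false ∷ xs) ys = refl

bit-and-map : ∀ n {A : Set} (f : A → Bool) (g : Fin n → A) →
  bit (and (mapᴸ f (tabulateᴸ g))) ≡ ∏F n (bit ∘ f ∘ g)
bit-and-map zero    f g = refl
bit-and-map (suc n) f g = trans (lemma (f (g zero)) _) (cong (bit (f (g zero)) *_) (bit-and-map n f (g ∘ suc)))
  where
  lemma : ∀ x y → bit (x ∧ y) ≡ bit x * bit y
  lemma true  y = sym (*-identityˡ (bit y))
  lemma false y = refl

bit-and-concatMap : ∀ n {A : Set} (f : A → List Bool) (g : Fin n → A) →
  bit (and (concatMap f (tabulateᴸ g))) ≡ ∏F n (bit ∘ and ∘ f ∘ g)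
bit-and-concatMap zero    f g = refl
bit-and-concatMap (suc n) f g =
  trans (bit-and-++ (f (g zero)) _) (cong (bit (and (f (g zero))) *_) (bit-and-concatMap n f (g ∘ suc)))

ne-≢ : ∀ {a b} → a ≢ b → ne a b ≡ 1
ne-≢ {zero}  {zero}  p = contradiction refl p
ne-≢ {zero}  {suc b} p = refl
ne-≢ {suc a} {zero}  p = refl
ne-≢ {suc a} {suc b} p = ne-≢ (p ∘ cong suc)

bit-constraint : ∀ {k} e (x y : Fin k) → bit (not (e ∧ does (x ≟ y))) ≡ σᴱ e (toℕ x) (toℕ y)
bit-constraint false x y = refl
bit-constraint true  x y with x ≟ y
... | yes refl = sym (cong₂ _+_ (lt-irrefl (toℕ x)) (lt-irrefl (toℕ x)))
... | no  x≢y  = sym (ne-≢ (x≢y ∘ toℕ-injective))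

σᴱ-sym : ∀ e a b → σᴱ e a b ≡ σᴱ e b a
σᴱ-sym false a b = refl
σᴱ-sym true  a b = +-comm (lt a b) (lt b a)

rowSat-tabulate : ∀ {n} (e : Fin n → Bool) d c → E.rowSat (tabulate e) d c ≡ ∏F n λ j → σᴱ (e j) d (lookup c j)
rowSat-tabulate e d []      = refl
rowSat-tabulate e d (a ∷ c) = cong (σᴱ (e zero) d a *_) (rowSat-tabulate (e ∘ suc) d c)

rowSat-idem : ∀ {n} (r : Vec Bool n) d c → E.rowSat r d c * E.rowSat r d c ≡ E.rowSat r d c
rowSat-idem []          d []      = refl
rowSat-idem (k ∷ r) d (a ∷ c) = trans (lemma (σᴱ k d a) (E.rowSat r d c)) (cong₂ _*_ (idem k) (rowSat-idem r d c))
  where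
  lemma : ∀ x y → (x * y) * (x * y) ≡ (x * x) * (y * y)
  lemma = solve-∀
  idem : ∀ k → σᴱ k d a * σᴱ k d a ≡ σᴱ k d a
  idem false = refl
  idem true  = ne-idem d a

-- The full product counts every constraint twice, which is harmless as constraints are 0 or 1.
sat-toStr : ∀ {n} (e : Fin n → Fin n → Bool) → (∀ i j → e i j ≡ e j i) → (∀ i → e i i ≡ false) → ∀ c →
  ∏F n (λ i → ∏F n λ j → σᴱ (e i j) (lookup c i) (lookup c j)) ≡ E.sat (toStr e) c
sat-toStr         e es ei []      = refl
sat-toStr {suc n} e es ei (a ∷ c) = begin-equality
  (σᴱ (e zero zero) a a * R) * ∏F n (λ i → σᴱ (e (suc i) zero) (lookup c i) a * T i)
    ≡⟨ cong₂ _*_ (trans (cong (λ k → σᴱ k a a * R) (ei zero)) (*-identityˡ R)) (∏F-* n _ T) ⟩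
  R * (∏F n (λ i → σᴱ (e (suc i) zero) (lookup c i) a) * ∏F n T)
    ≡⟨ cong₂ (λ x y → R * (x * y)) (∏F-cong n λ i → trans (cong (λ k → σᴱ k (lookup c i) a) (es (suc i) zero)) (σᴱ-sym (e zero (suc i)) (lookup c i) a))
         (sat-toStr (λ i j → e (suc i) (suc j)) (λ i j → es (suc i) (suc j)) (ei ∘ suc) c) ⟩
  R * (R * S)
    ≡⟨ *-assoc R R S ⟨
  (R * R) * S
    ≡⟨ cong (λ x → x * x * S) (rowSat-tabulate (e zero ∘ suc) a c) ⟨
  (R′ * R′) * S
    ≡⟨ cong (_* S) (rowSat-idem (tabulate (e zero ∘ suc)) a c) ⟩
  R′ * S ∎
  where
  R = ∏F n λ j → σᴱ (e zero (suc j)) a (lookup c j)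
  R′ = E.rowSat (tabulate (e zero ∘ suc)) a c
  T : Fin n → ℕ
  T i = ∏F n λ j → σᴱ (e (suc i) (suc j)) (lookup c i) (lookup c j)
  S = E.sat (toStr λ i j → e (suc i) (suc j)) c

bit-isProper : ∀ {n k} (G : Graph n) (c : Vec (Fin k) n) → bit (isProper G c) ≡ E.sat (toStr (adj G)) (map toℕ c)
bit-isProper {n} G c = begin-equality
  bit (isProper G c)
    ≡⟨ bit-and-concatMap n _ id ⟩
  ∏F n (λ i → bit (and (mapᴸ (λ j → not (adj G i j ∧ does (lookup c i ≟ lookup c j))) (allFin n))))
    ≡⟨ ∏F-cong n (λ i → bit-and-map n _ id) ⟩
  ∏F n (λ i → ∏F n λ j → bit (not (adj G i j ∧ does (lookup c i ≟ lookup c j))))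
    ≡⟨ ∏F-cong n (λ i → ∏F-cong n λ j → trans (bit-constraint (adj G i j) (lookup c i) (lookup c j))
         (cong₂ (σᴱ (adj G i j)) (sym (lookup-map i toℕ c)) (sym (lookup-map j toℕ c)))) ⟩
  ∏F n (λ i → ∏F n λ j → σᴱ (adj G i j) (lookup (map toℕ c) i) (lookup (map toℕ c) j))
    ≡⟨ sat-toStr (adj G) (Graph.sym G) (irrefl G) (map toℕ c) ⟩
  E.sat (toStr (adj G)) (map toℕ c) ∎

sum-map : {A : Set} (f : A → ℕ) (xs : List A) → sum (mapᴸ f xs) ≡ ∑L xs f
sum-map f []       = refl
sum-map f (x ∷ xs) = cong (f x +_) (sum-map f xs)

∑L-tabulate : ∀ k {A : Set} (g : Fin k → A) (f : A → ℕ) (h : ℕ → ℕ) → (∀ i → f (g i) ≡ h (toℕ i)) →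
  ∑L (tabulateᴸ g) f ≡ ∑ k h
∑L-tabulate zero    g f h e = refl
∑L-tabulate (suc k) g f h e = cong₂ _+_ (e zero) (∑L-tabulate k (g ∘ suc) f (h ∘ suc) (e ∘ suc))

∑L-concatMap : {A B : Set} (F : A → List B) (xs : List A) (f : B → ℕ) →
  ∑L (concatMap F xs) f ≡ ∑L xs λ x → ∑L (F x) f
∑L-concatMap F []       f = refl
∑L-concatMap F (x ∷ xs) f = trans (∑L-++ (F x) _ f) (cong (∑L (F x) f +_) (∑L-concatMap F xs f))

∑L-allColourings : ∀ n k (f : Vec (Fin k) n → ℕ) (h : Vec ℕ n → ℕ) → (∀ c → f c ≡ h (map toℕ c)) →
  ∑L (allColourings n k) f ≡ ∑V n k h
∑L-allColourings zero    k f h e = trans (+-identityʳ _) (e [])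
∑L-allColourings (suc n) k f h e = trans (∑L-concatMap _ (allFin k) f)
  (∑L-tabulate k id _ _ λ i → trans (∑L-map (i ∷_) (allColourings n k) f)
    (∑L-allColourings n k (f ∘ (i ∷_)) (h ∘ (toℕ i ∷_)) (e ∘ (i ∷_))))

chromPoly-count : ∀ {n} (G : Graph n) k → chromPoly G k ≡ E.count (toStr (adj G)) k
chromPoly-count {n} G k = trans (sum-map _ (allColourings n k)) (∑L-allColourings n k _ _ (bit-isProper G))

-- Universal vertices

∑F : ∀ n → (Fin n → Bool) → ℕ
∑F zero    f = 0
∑F (suc n) f = bit (f zero) + ∑F n (f ∘ suc)

∑F-≤ : ∀ n f → ∑F n f ≤ n
∑F-≤ zero    f = z≤n
∑F-≤ (suc n) f with f zero
... | true  = s≤s (∑F-≤ n (f ∘ suc))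
... | false = m≤n⇒m≤1+n (∑F-≤ n (f ∘ suc))

∑F-full : ∀ n f → ∑F n f ≡ n → ∀ w → f w ≡ true
∑F-full (suc n) f e w with f zero in eq
∑F-full (suc n) f e zero    | true  = eq
∑F-full (suc n) f e (suc w) | true  = ∑F-full n (f ∘ suc) (cong (_∸ 1) e) w
∑F-full (suc n) f e w       | false = contradiction (≤-reflexive (sym e)) (<⇒≱ (s≤s (∑F-≤ n (f ∘ suc))))

∑F-almost-full : ∀ n f v → f v ≡ false → ∑F n f ≡ n ∸ 1 → ∀ w → w ≢ v → f w ≡ true
∑F-almost-full (suc n) f zero fv e zero w≢v = contradiction refl w≢v
∑F-almost-full (suc n) f zero fv e (suc w) _ = ∑F-full n (f ∘ suc) (trans (cong (λ b → bit b + ∑F n (f ∘ suc)) (sym fv)) e) w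
∑F-almost-full (suc (suc n)) f (suc v) fv e w w≢v with f zero in eq
∑F-almost-full (suc (suc n)) f (suc v) fv e zero    w≢v | true = eq
∑F-almost-full (suc (suc n)) f (suc v) fv e (suc w) w≢v | true =
  ∑F-almost-full (suc n) (f ∘ suc) v fv (cong (_∸ 1) e) w (w≢v ∘ cong suc)
... | false with trans (sym fv) (∑F-full (suc n) (f ∘ suc) e v)
... | ()

degree-∑F : ∀ {n} (G : Graph n) v → degree G v ≡ ∑F n (adj G v)
degree-∑F {n} G v = trans (sum-map _ (allFin n)) (go n id)
  where
  go : ∀ k (g : Fin k → Fin n) → ∑L (tabulateᴸ g) (bit ∘ adj G v) ≡ ∑F k (adj G v ∘ g)
  go zero    g = refl
  go (suc k) g = cong (bit (adj G v (g zero)) +_) (go k (g ∘ suc))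

module EX = E.Extraction id σᴱ-sym

tabulate-true : ∀ {n} (e : Fin n → Bool) → (∀ i → e i ≡ true) → tabulate e ≡ replicate n true
tabulate-true {zero}  e p = refl
tabulate-true {suc n} e p = cong₂ _∷_ (p zero) (tabulate-true (e ∘ suc) (p ∘ suc))

extract-universal : ∀ {n} (e : Fin (suc n) → Fin (suc n) → Bool) → (∀ i j → e i j ≡ e j i) →
  ∀ v → (∀ w → w ≢ v → e v w ≡ true) → proj₁ (EX.extract (toStr e) v) ≡ replicate n true
extract-universal         e es zero    p = tabulate-true _ λ i → p (suc i) λ ()
extract-universal {suc n} e es (suc v) p = cong₂ _∷_
  (trans (lookup∘tabulate (e zero ∘ suc) v) (trans (es zero (suc v)) (p zero λ ())))
  (extract-universal (λ i j → e (suc i) (suc j)) (λ i j → es (suc i) (suc j)) v λ w w≢v → p (suc w) (w≢v ∘ suc-injective))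

link : ∀ {m} → Graph (suc m) → Fin (suc m) → Str Bool m
link H v = proj₂ (EX.extract (toStr (adj H)) v)

chromPoly-universal : ∀ {m} (H : Graph (suc m)) v → degree H v ≡ m → ∀ j →
  chromPoly H (suc j) ≡ suc j * E.count (link H v) j
chromPoly-universal {m} H v deg j = begin-equality
  chromPoly H (suc j)
    ≡⟨ chromPoly-count H (suc j) ⟩
  E.count (toStr (adj H)) (suc j)
    ≡⟨ EX.count-extract (toStr (adj H)) v (suc j) ⟩
  E.count (proj₁ (EX.extract (toStr (adj H)) v) ∷ link H v) (suc j)
    ≡⟨ cong (λ r → E.count (r ∷ link H v) (suc j)) (extract-universal (adj H) (Graph.sym H) v
         (∑F-almost-full (suc m) (adj H v) v (irrefl H v) (trans (sym (degree-∑F H v)) deg))) ⟩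
  E.count (replicate m true ∷ link H v) (suc j)
    ≡⟨ count-cone (link H v) j ⟩
  suc j * E.count (link H v) j ∎

coeffA-universal : ∀ {m} (G H : Graph (suc m)) → ChromEquiv G H → ∀ v → degree H v ≡ m → ∀ j →
  coeffA G j ≡ suc j ^ m ∸ E.count (link H v) j
coeffA-universal {m} G H equiv v deg j = begin-equality
  (suc j * suc j ^ m ∸ chromPoly G (suc j)) / suc j
    ≡⟨ cong (λ x → (suc j * suc j ^ m ∸ x) / suc j) (trans (equiv (suc j)) (chromPoly-universal H v deg j)) ⟩
  (suc j * suc j ^ m ∸ suc j * E.count (link H v) j) / suc j
    ≡⟨ cong (_/ suc j) (*-distribˡ-∸ (suc j) (suc j ^ m) (E.count (link H v) j)) ⟨
  (suc j * (suc j ^ m ∸ E.count (link H v) j)) / suc j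
    ≡⟨ trans (cong (_/ suc j) (*-comm (suc j) (suc j ^ m ∸ E.count (link H v) j))) (m*n/n≡m _ (suc j)) ⟩
  suc j ^ m ∸ E.count (link H v) j ∎

-- The h-vector

power-shift : ∀ m j → j ^ suc m ≡ iter sums (2 + m) (shift (eul m)) j
power-shift m j = trans (lemma j) (sym (iter-commute sums-cong sums-shift (2 + m) (eul m) j))
  where
  lemma : ∀ j → j ^ suc m ≡ shift (iter sums (2 + m) (eul m)) j
  lemma zero    = refl
  lemma (suc j) = worpitzky m j

-- The series of j^(m+1) is t times that of (j+1)^(m+1), so the difference gains a factor 1-t and
-- loses one power in the denominator.
power-difference : ∀ m j → suc j ^ suc m ≡ iter sums (suc m) (eul m) j + j ^ suc m
power-difference m j = trans (worpitzky m j) (trans (sums-unfold (iter sums (suc m) (eul m)) j)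
  (cong (iter sums (suc m) (eul m) j +_)
    (trans (sym (iter-commute sums-cong sums-shift (2 + m) (eul m) j)) (sym (power-shift m j)))))

edgeless : ∀ n → Str Bool n
edgeless zero    = []
edgeless (suc n) = replicate n false ∷ edgeless n

count-edgeless : ∀ n j → E.count (edgeless n) j ≡ j ^ n
count-edgeless zero    j = refl
count-edgeless (suc n) j = trans (count-isolated (edgeless n) j) (cong (j *_) (count-edgeless n j))

-- For the edgeless graph on m+1 vertices the chromatic numerator is t A_m(t), which therefore lies
-- in the cone. The factor t accounts for the indices i+1 and j+1.
eul-≤ : ∀ m {i j} → i ≤ j → i + j ≤ m → eul m i ≤ eul m j
eul-≤ m {i} {j} i≤j i+j≤m with Good-count (edgeless (suc m))
... | w , cone , eq = subst₂ _≤_ (sym (num (suc i))) (sym (num (suc j)))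
  (Cone-≤ cone (s≤s i≤j) (s≤s (subst (_≤ suc m) (sym (+-suc i j)) (s≤s i+j≤m))))
  where
  num : shift (eul m) ≗ w
  num = iter-sums-injective (2 + m) λ j →
    trans (sym (power-shift m j)) (trans (sym (count-edgeless (suc m) j)) (eq j))

Good-ears : ∀ {m} (s : Str Bool (suc m)) → Good m (λ j → ∑L (ears s) λ t → E.count t j)
Good-ears {zero}  s = Good-𝟘
Good-ears {suc m} s = Good-∑L (ears s) E.count Good-count

module HVector {m : ℕ} (s : Str Bool (suc m)) where

  w : Series
  w = proj₁ (Good-ears s)

  h : Series
  h = eul m ⊕ w

  h-series : ∀ j → suc j ^ suc m ≡ iter sums (suc m) h j + E.count s j
  h-series j = begin-equality
    suc j ^ suc m
      ≡⟨ power-difference m j ⟩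
    y + j ^ suc m
      ≡⟨ cong (y +_) (trans (sym (count-ears s j)) (+-comm (E.count s j) _)) ⟩
    y + (∑L (ears s) (λ t → E.count t j) + E.count s j)
      ≡⟨ +-assoc y _ _ ⟨
    (y + ∑L (ears s) (λ t → E.count t j)) + E.count s j
      ≡⟨ cong (λ x → (y + x) + E.count s j) (proj₂ (proj₂ (Good-ears s)) j) ⟩
    (y + iter sums (suc m) w j) + E.count s j
      ≡⟨ cong (_+ E.count s j) (iter-sums-⊕ (suc m) (eul m) w j) ⟨
    iter sums (suc m) h j + E.count s j ∎
    where
    y = iter sums (suc m) (eul m) j

  h-zero : h 0 ≡ 1
  h-zero = begin-equality
    h 0                                  ≡⟨ iter-sums-zero (suc m) h ⟨
    iter sums (suc m) h 0                ≡⟨ +-identityʳ _ ⟨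
    iter sums (suc m) h 0 + E.count s 0  ≡⟨ h-series 0 ⟨
    1 ^ suc m                            ≡⟨ ^-zeroˡ (suc m) ⟩
    1                                    ∎

  w-≤ : ∀ {i j} → i ≤ j → i + j ≤ suc m → w i ≤ w j
  w-≤ = Cone-≤ (proj₁ (proj₂ (Good-ears s)))

  h-≤ : ∀ {i j} → i ≤ j → i + j ≤ m → h i ≤ h j
  h-≤ i≤j p = +-mono-≤ (eul-≤ m i≤j p) (w-≤ i≤j (m≤n⇒m≤1+n p))

  -- Let v be the chromatic numerator of s. Comparing numerators over (1-t)^(m+2) gives A_m = (1-t)
  -- h + v, stated in `total` after division by 1-t, and v has natural coefficients.
  h-growth : ∀ i → h (suc i) ≤ h i + eul m (suc i)
  h-growth i with Good-count s
  ... | v , _ , eq = +-cancelˡ-≤ (sums v i) _ _ (begin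
    sums v i + h (suc i)           ≤⟨ +-monoˡ-≤ (h (suc i)) (m≤m+n (sums v i) (v (suc i))) ⟩
    sums v (suc i) + h (suc i)     ≡⟨ +-comm (sums v (suc i)) _ ⟩
    h (suc i) + sums v (suc i)     ≡⟨ total (suc i) ⟨
    sums (eul m) i + eul m (suc i) ≡⟨ cong (_+ eul m (suc i)) (total i) ⟩
    (h i + sums v i) + eul m (suc i) ≡⟨ lemma (h i) (sums v i) _ ⟩
    sums v i + (h i + eul m (suc i)) ∎)
    where
    lemma : ∀ x y z → (x + y) + z ≡ y + (x + z)
    lemma = solve-∀
    total : sums (eul m) ≗ h ⊕ sums v
    total = iter-sums-injective (suc m) λ j →
      trans (iter-commute {G = sums} sums-cong (λ _ _ → refl) (suc m) (eul m) j) (trans (sym (worpitzky m j)) (trans (h-series j)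
      (trans (cong (iter sums (suc m) h j +_) (trans (eq j) (sym (iter-commute {G = sums} sums-cong (λ _ _ → refl) (suc m) v j))))
        (sym (iter-sums-⊕ (suc m) h (sums v) j)))))

  h-macaulay : ∀ b → 2 * suc (suc b) ≤ suc m → MacaulayBound (suc b) (h (suc b) ∸ h b) (h (suc (suc b)) ∸ h (suc b))
  h-macaulay b p = macaulay-eulerian k b _ _ lower upper
    where
    i = suc b
    -- The distance from the middle: m = 2i+1+k, so i+1 descents leave k+i ascents.
    k = suc m ∸ 2 * suc i
    m≡ : m ≡ (k + i) + suc i
    m≡ = cong (_∸ 1) (trans (sym (m∸n+n≡m p)) (lemma k i))
      where
      lemma : ∀ k i → k + 2 * suc i ≡ suc ((k + i) + suc i)
      lemma = solve-∀
    upper : h (suc i) ∸ h i ≤ eulAD (k + i) (suc i)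
    upper = ≤-trans (m≤n+o⇒m∸n≤o _ (h i) (h-growth i))
      (≤-reflexive (trans (cong (λ z → eul z (suc i)) m≡) (eul≡eulAD (k + i) (suc i))))
    A-i : eul m i ≡ eulAD (2 + (k + b)) i
    A-i = trans (cong (λ z → eul z i) (trans m≡ (lemma k b))) (eul≡eulAD (2 + (k + b)) i)
      where
      lemma : ∀ k b → (k + suc b) + suc (suc b) ≡ (2 + (k + b)) + suc b
      lemma = solve-∀
    A-b : eul m b ≡ eulAD (3 + (k + b)) b
    A-b = trans (cong (λ z → eul z b) (trans m≡ (lemma k b))) (eul≡eulAD (3 + (k + b)) b)
      where
      lemma : ∀ k b → (k + suc b) + suc (suc b) ≡ (3 + (k + b)) + b
      lemma = solve-∀
    b+i≤ : b + i ≤ suc m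
    b+i≤ = ≤-trans (≤-trans (m≤m+n (b + i) 3) (≤-reflexive (lemma b))) p
      where
      lemma : ∀ b → (b + suc b) + 3 ≡ 2 * suc (suc b)
      lemma = solve-∀
    lower : gap (suc k) i ≤ h i ∸ h b
    lower = m+n≤o⇒m≤o∸n _ (begin
      gap (suc k) i + (eul m b + w b)                     ≡⟨ cong (λ z → gap (suc k) i + (z + w b)) A-b ⟩
      gap (suc k) i + (eulAD (3 + (k + b)) b + w b)       ≡⟨ lemma (gap (suc k) i) _ (w b) ⟩
      (eulAD (3 + (k + b)) b + gap (suc k) i) + w b       ≡⟨ cong (_+ w b) (gap-spec (suc k) b) ⟩
      eulAD (2 + (k + b)) i + w b                         ≡⟨ cong (_+ w b) A-i ⟨
      eul m i + w b                                       ≤⟨ +-monoʳ-≤ (eul m i) (w-≤ (n≤1+n b) b+i≤) ⟩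
      eul m i + w i                                       ∎)
      where
      lemma : ∀ x y z → x + (y + z) ≡ (y + x) + z
      lemma = solve-∀

i≤m/2⇒2i≤m : ∀ {i} m → i ≤ m / 2 → 2 * i ≤ m
i≤m/2⇒2i≤m {i} m p = ≤-trans (≤-reflexive (*-comm 2 i)) (≤-trans (*-monoˡ-≤ 2 p) (m/n*n≤m m 2))

theorem5p7 : (n : ℕ) → 2 ≤ n → (G H : Graph n) → ChromEquiv G H
    → Σ (Fin n) (λ v → degree H v ≡ n ∸ 1)
    → ((i : ℕ) → suc i ≤ (n ∸ 2) / 2 → hPrime G i ℤ.≤ hPrime G (suc i))
    × ((i : ℕ) → 2 * i ≤ n ∸ 2 → hPrime G i ℤ.≤ hPrime G (n ∸ 2 ∸ i))
    × IsMVector ((n ∸ 1) / 2) (diffSeq (hPrime G))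
theorem5p7 (suc zero) (s≤s ())
theorem5p7 (suc (suc m)) _ G H equiv (v , deg) = increasing , symmetric , first , nonneg , bounds
  where
  open HVector (link H v)
  hPrime≡h : ∀ i → hPrime G i ≡ ℤ.+ h i
  hPrime≡h i = trans (sumTo-cong i λ k _ → cong (λ z → sign k ℤ.* ℤ.+ (suc m C k) ℤ.* ℤ.+ z) (coeff (i ∸ k)))
                     (differences-iter-sums (suc m) h i)
    where
    coeff : ∀ j → coeffA G j ≡ iter sums (suc m) h j
    coeff j = trans (coeffA-universal G H equiv v deg j)
      (trans (cong (_∸ E.count (link H v) j) (h-series j)) (m+n∸n≡m (iter sums (suc m) h j) (E.count (link H v) j)))

  hPrime-≤ : ∀ {i j} → i ≤ j → i + j ≤ m → hPrime G i ℤ.≤ hPrime G j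
  hPrime-≤ {i} {j} p q = subst₂ ℤ._≤_ (sym (hPrime≡h i)) (sym (hPrime≡h j)) (ℤ.+≤+ (h-≤ p q))

  -- The M-vector reaches index (m+1)/2 rounded down, one beyond part (1) when m is odd. Its
  -- increments still satisfy i + (i+1) ≤ m, which is all that `h-≤` asks for.
  i+suc : ∀ i {k} → 2 * suc i ≤ suc k → i + suc i ≤ k
  i+suc i {k} p = ≤-pred (subst (_≤ suc k) (cong (λ z → suc (i + z)) (+-identityʳ (suc i))) p)

  difference : ∀ i → i + suc i ≤ m → diffSeq (hPrime G) (suc i) ≡ ℤ.+ (h (suc i) ∸ h i)
  difference i p = trans (cong₂ ℤ._-_ (hPrime≡h (suc i)) (hPrime≡h i))
    (trans (ℤₚ.m-n≡m⊖n (h (suc i)) (h i)) (ℤₚ.⊖-≥ (h-≤ (n≤1+n i) p)))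

  increasing : (i : ℕ) → suc i ≤ m / 2 → hPrime G i ℤ.≤ hPrime G (suc i)
  increasing i p = hPrime-≤ (n≤1+n i) (i+suc i (m≤n⇒m≤1+n (i≤m/2⇒2i≤m m p)))

  symmetric : (i : ℕ) → 2 * i ≤ m → hPrime G i ℤ.≤ hPrime G (m ∸ i)
  symmetric i p = hPrime-≤ (m+n≤o⇒m≤o∸n i i+i≤m) (≤-reflexive (m+[n∸m]≡n (≤-trans (m≤m+n i i) i+i≤m)))
    where
    i+i≤m : i + i ≤ m
    i+i≤m = subst (λ z → i + z ≤ m) (+-identityʳ i) p

  first : hPrime G 0 ≡ ℤ.+ 1
  first = trans (hPrime≡h 0) (cong ℤ.+_ h-zero)

  nonneg : ∀ i → i ≤ suc m / 2 → ℤ.+ 0 ℤ.≤ diffSeq (hPrime G) i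
  nonneg zero    _ = subst (ℤ.+ 0 ℤ.≤_) (sym first) (ℤ.+≤+ z≤n)
  nonneg (suc i) p = subst (ℤ.+ 0 ℤ.≤_) (sym (difference i (i+suc i (i≤m/2⇒2i≤m (suc m) p)))) (ℤ.+≤+ z≤n)

  bounds : ∀ i → 1 ≤ i → suc i ≤ suc m / 2 →
    MacaulayBound i (ℤ.∣ diffSeq (hPrime G) i ∣) (ℤ.∣ diffSeq (hPrime G) (suc i) ∣)
  bounds (suc b) _ p = subst₂ (MacaulayBound (suc b))
    (cong ℤ.∣_∣ (sym (difference b (i+suc b (≤-trans (*-monoʳ-≤ 2 (n≤1+n (suc b))) q)))))
    (cong ℤ.∣_∣ (sym (difference (suc b) (i+suc (suc b) q))))
    (h-macaulay b q)
    where q = i≤m/2⇒2i≤m (suc m) p
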